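{- There exists $n_0$ such that for all $n\ge n_0$, a red-blue $K_n$ contains at most \[\sum_{i\in[3]}\binom{n_i}{2}\binom{n-n_i}{2}=\frac{1}{27}n^4+O(n^3)\] copies of $H$, where $(n_1,n_2,n_3)$ is the unique vector of positive integers with $n_1+n_2+n_3=n$ and $n_1\ge n_2\ge n_3\ge n_1-1$. Moreover, this is achieved if and only if the red edges form the complete tripartite graph with parts of sizes $n_1,n_2,n_3$ (the Turán graph $T_3(n)$).
   Context: A red-blue $K_n$ is a complete graph on $n$ vertices each of whose edges is coloured red or blue. $H$ is the red-blue graph on four vertices $a,b,c,d$ consisting of a red $4$-cycle $abcd$ together with the blue chord $ac$ (so $H$ is $K_4$ minus an edge, with the $4$-cycle red and the remaining edge blue). A copy of $H$ in $G$ is a subgraph of $G$ isomorphic to $H$ by an isomorphism preserving edge colours. -}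

module Defs where

open import Data.Nat using (ℕ; zero; suc; _+_; _*_; _∸_; _<ᵇ_)
open import Data.Nat.Combinatorics using (_C_)
open import Data.Fin using (Fin; zero; suc; toℕ; _≟_)
open import Data.Bool using (Bool; true; false; _∧_; not; if_then_else_)
open import Data.Product using (Σ; _×_; _,_; proj₁)
open import Function.Bundles using (_⇔_)
open import Relation.Nullary using (does; ¬_)
open import Relation.Binary.PropositionalEquality using (_≡_)

data Colour : Set where
  red blue : Colour

isRed : Colour → Bool
isRed red  = true
isRed blue = false

isBlue : Colour → Bool
isBlue c = not (isRed c)

-- A red-blue K_n: a symmetric colouring of pairs of vertices of Fin n.
-- (The value on the diagonal x = x is irrelevant and never used.)
Colouring : ℕ → Set
Colouring n = Σ (Fin n → Fin n → Colour) (λ c → ∀ x y → c x y ≡ c y x)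

sumFin : ∀ n → (Fin n → ℕ) → ℕ
sumFin zero    f = 0
sumFin (suc n) f = f zero + sumFin n (λ i → f (suc i))

indicator : Bool → ℕ
indicator b = if b then 1 else 0

neq : ∀ {n} → Fin n → Fin n → Bool
neq x y = not (does (x ≟ y))

-- (a,b,c,d) is a copy of H, written canonically: a < c, b < d, all four
-- vertices distinct, chord ac blue, 4-cycle abcd red.  A copy of H (as a
-- subgraph) is determined by its blue chord {a,c} and the remaining pair
-- {b,d}, so each copy is counted exactly once.
isCopy : ∀ {n} → Colouring n → Fin n → Fin n → Fin n → Fin n → Bool
isCopy (col , _) a b c d =
  (toℕ a <ᵇ toℕ c) ∧ (toℕ b <ᵇ toℕ d) ∧
  neq a b ∧ neq a d ∧ neq c b ∧ neq c d ∧
  isBlue (col a c) ∧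
  isRed (col a b) ∧ isRed (col b c) ∧ isRed (col c d) ∧ isRed (col d a)

copiesH : ∀ {n} → Colouring n → ℕ
copiesH {n} col =
  sumFin n λ a → sumFin n λ b → sumFin n λ c → sumFin n λ d →
    indicator (isCopy col a b c d)

turanBound : ℕ → ℕ → ℕ → ℕ → ℕ
turanBound n n₁ n₂ n₃ =
  (n₁ C 2) * ((n ∸ n₁) C 2) + (n₂ C 2) * ((n ∸ n₂) C 2) + (n₃ C 2) * ((n ∸ n₃) C 2)

partSize : ∀ {n} → (Fin n → Fin 3) → Fin 3 → ℕ
partSize {n} p i = sumFin n (λ x → indicator (does (p x ≟ i)))

RedIsCompleteTripartite : ∀ {n} → Colouring n → ℕ → ℕ → ℕ → Set
RedIsCompleteTripartite {n} col n₁ n₂ n₃ =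
  Σ (Fin n → Fin 3) λ p →
    (partSize p zero ≡ n₁) × (partSize p (suc zero) ≡ n₂) × (partSize p (suc (suc zero)) ≡ n₃) ×
    (∀ x y → ¬ (x ≡ y) → (proj₁ col x y ≡ red) ⇔ (¬ (p x ≡ p y)))

{-# OPTIONS --safe #-}

-- For a vertex v of red degree d and blue degree c, every blue neighbour u has at most d common red
-- neighbours with v, so v is a chord end in at most c · d(d − 1)/2 copies; with c + d = n − 1 this is
-- largest near d = 2n/3, and summing over v already gives n⁴/27 + O(n³). For n = 3m this bound is exact.
-- For n = 3m + 1 and n = 3m + 2 the maximum would require every non-red-neighbourhood ("class") to have
-- m + 1 elements. A vertex is closed if every blue neighbour sees all its red neighbours, and clean if it
-- is closed and has the optimal degree. The class of a closed vertex is completely joined in red to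
-- its complement, so distinct classes of clean vertices are disjoint and there are at most two of them.
-- Every vertex that is not clean loses an amount linear in m, and every vertex outside two clean classes
-- has too large a degree; comparing the total loss with that of the Turán graph for 0, 1 or 2 clean
-- classes proves the bound. In case of equality all vertices are closed, so the classes partition
-- the vertex set.
module Submission where

open import Defs
open import Data.Nat using (ℕ; zero; suc; _+_; _*_; _∸_; _≤_; _<_; _<ᵇ_; _<?_; z≤n; s≤s)
open import Data.Nat.Properties hiding (_≟_; _<?_)
open import Data.Nat.Combinatorics using (_C_; nC1≡n; nCk+nC[k+1]≡[n+1]C[k+1])
open import Data.Nat.Tactic.RingSolver using (solve; solve-∀)
open import Algebra.Properties.CommutativeSemigroup +-commutativeSemigroup using (interchange)
open import Data.Fin using (Fin; zero; suc; toℕ; _≟_)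
open import Data.Fin.Properties using (any?)
open import Data.Bool using (Bool; true; false; _∧_; not)
open import Data.Bool.Properties using (∧-comm; ∧-commutativeMonoid; not-injective) renaming (_≟_ to _≟ᵇ_)
open import Algebra.Solver.CommutativeMonoid ∧-commutativeMonoid using (_⊕_; _⊜_; id) renaming (solve to solve-∧)
open import Data.Product using (Σ; ∃; _×_; _,_; proj₁; proj₂)
open import Data.Sum using (_⊎_; inj₁; inj₂)
open import Data.List using ([]; _∷_)
open import Data.Empty using (⊥; ⊥-elim)
open import Function using (case_of_)
open import Function.Bundles using (_⇔_; mk⇔; Equivalence)
open import Relation.Nullary using (does; yes; no; ¬_; contradiction)
open import Relation.Nullary.Decidable using (True; toWitness; dec-true; dec-false; _×-dec_)
open import Relation.Binary.Definitions using (tri<; tri≈; tri>)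
open import Relation.Binary.PropositionalEquality

-- Finite sums and counting

slack : ∀ {m n} k → m + k ≡ n → m ≤ n
slack {m} k refl = m≤m+n m k

true≢false : ∀ {b} → b ≡ true → b ≡ false → ⊥
true≢false refl ()

sum-cong : ∀ n {f g : Fin n → ℕ} → (∀ i → f i ≡ g i) → sumFin n f ≡ sumFin n g
sum-cong zero    e = refl
sum-cong (suc n) e = cong₂ _+_ (e zero) (sum-cong n (λ i → e (suc i)))

sum-mono : ∀ n {f g : Fin n → ℕ} → (∀ i → f i ≤ g i) → sumFin n f ≤ sumFin n g
sum-mono zero    le = z≤n
sum-mono (suc n) le = +-mono-≤ (le zero) (sum-mono n (λ i → le (suc i)))

sum-mono-tight : ∀ n {f g : Fin n → ℕ} → (∀ i → f i ≤ g i) →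
                 sumFin n f ≡ sumFin n g → ∀ i → f i ≡ g i
sum-mono-tight (suc n) {f} {g} le e = λ where
    zero    → head
    (suc i) → sum-mono-tight n (λ j → le (suc j)) tail i
  where
  head : f zero ≡ g zero
  head = ≤-antisym (le zero) (+-cancelʳ-≤ (sumFin n (λ i → g (suc i))) _ _
           (≤-trans (≤-reflexive (sym e)) (+-monoʳ-≤ (f zero) (sum-mono n (λ i → le (suc i))))))
  tail : sumFin n (λ i → f (suc i)) ≡ sumFin n (λ i → g (suc i))
  tail = +-cancelˡ-≡ (f zero) _ _ (trans e (cong (_+ _) (sym head)))

sum-+ : ∀ n (f g : Fin n → ℕ) → sumFin n (λ i → f i + g i) ≡ sumFin n f + sumFin n g
sum-+ zero    f g = refl
sum-+ (suc n) f g = trans (cong (f zero + g zero +_) (sum-+ n _ _)) (interchange (f zero) (g zero) _ _)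

sum-*ˡ : ∀ n k (f : Fin n → ℕ) → sumFin n (λ i → k * f i) ≡ k * sumFin n f
sum-*ˡ zero    k f = sym (*-zeroʳ k)
sum-*ˡ (suc n) k f = trans (cong (k * f zero +_) (sum-*ˡ n k _)) (sym (*-distribˡ-+ k (f zero) _))

sum-*ʳ : ∀ n k (f : Fin n → ℕ) → sumFin n (λ i → f i * k) ≡ sumFin n f * k
sum-*ʳ n k f = trans (sum-cong n (λ i → *-comm (f i) k)) (trans (sum-*ˡ n k f) (*-comm k _))

sum-const : ∀ n k → sumFin n (λ _ → k) ≡ n * k
sum-const zero    k = refl
sum-const (suc n) k = cong (k +_) (sum-const n k)

sum-swap : ∀ m n (f : Fin m → Fin n → ℕ) →
           sumFin m (λ i → sumFin n (f i)) ≡ sumFin n (λ j → sumFin m (λ i → f i j))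
sum-swap zero    n f = sym (trans (sum-const n 0) (*-zeroʳ n))
sum-swap (suc m) n f = trans (cong (sumFin n (f zero) +_) (sum-swap m n _)) (sym (sum-+ n _ _))

sum-delta : ∀ n (i : Fin n) (f : Fin n → ℕ) →
            sumFin n (λ j → indicator (does (i ≟ j)) * f j) ≡ f i
sum-delta (suc n) zero f = trans
  (cong (f zero + 0 +_) (trans (sum-const n 0) (*-zeroʳ n)))
  (trans (+-identityʳ _) (+-identityʳ _))
sum-delta (suc n) (suc i) f = sum-delta n i (λ j → f (suc j))

sum-bound : ∀ n {f g : Fin n → ℕ} {M} → (∀ i → f i + g i ≤ M) → sumFin n f + sumFin n g ≤ n * M
sum-bound n {f} {g} {M} le = subst₂ _≤_ (sum-+ n f g) (sum-const n M) (sum-mono n le)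

sum-bound-tight : ∀ n {f g : Fin n → ℕ} {M} → (∀ i → f i + g i ≤ M) →
                  sumFin n f + sumFin n g ≡ n * M → ∀ i → f i + g i ≡ M
sum-bound-tight n {f} {g} {M} le e =
  sum-mono-tight n le (trans (sum-+ n f g) (trans e (sym (sum-const n M))))

indicator-∧ : ∀ p q → indicator (p ∧ q) ≡ indicator p * indicator q
indicator-∧ true  q = sym (+-identityʳ _)
indicator-∧ false q = refl

count : ∀ {n} → (Fin n → Bool) → ℕ
count {n} f = sumFin n (λ i → indicator (f i))

indicator-mono : ∀ {p q} → (p ≡ true → q ≡ true) → indicator p ≤ indicator q
indicator-mono {false} imp = z≤n
indicator-mono {true}  imp rewrite imp refl = ≤-refl

indicator-injective : ∀ {p q} → indicator p ≡ indicator q → p ≡ q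
indicator-injective {false} {false} e = refl
indicator-injective {true}  {true}  e = refl

count-cong : ∀ {n} {f g : Fin n → Bool} → (∀ i → f i ≡ g i) → count f ≡ count g
count-cong {n} e = sum-cong n (λ i → cong indicator (e i))

count-mono : ∀ {n} {f g : Fin n → Bool} → (∀ i → f i ≡ true → g i ≡ true) → count f ≤ count g
count-mono {n} imp = sum-mono n (λ i → indicator-mono (imp i))

count-mono-tight : ∀ {n} {f g : Fin n → Bool} → (∀ i → f i ≡ true → g i ≡ true) →
                   count f ≡ count g → ∀ i → f i ≡ g i
count-mono-tight {n} imp e i = indicator-injective (sum-mono-tight n (λ j → indicator-mono (imp j)) e i)

count-mono-< : ∀ {n} {f g : Fin n → Bool} → (∀ i → f i ≡ true → g i ≡ true) →
               ∀ i → f i ≡ false → g i ≡ true → count f < count g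
count-mono-< imp i fi gi = ≤∧≢⇒< (count-mono imp)
  (λ e → true≢false gi (trans (sym (count-mono-tight imp e i)) fi))

count-not : ∀ {n} (f : Fin n → Bool) → count f + count (λ i → not (f i)) ≡ n
count-not {n} f = trans (sym (sum-+ n _ _)) (trans (sum-cong n (λ i → h (f i)))
                    (trans (sum-const n 1) (*-identityʳ n)))
  where
  h : ∀ p → indicator p + indicator (not p) ≡ 1
  h true  = refl
  h false = refl

count-witness : ∀ {n} (f : Fin n → Bool) → 0 < count f → ∃ λ i → f i ≡ true
count-witness {suc n} f pos with f zero in eq
... | true  = zero , eq
... | false = let i , fi = count-witness (λ i → f (suc i)) pos in suc i , fi

-- Pairs of distinct elements

neq-sym : ∀ {n} (x y : Fin n) → neq x y ≡ neq y x
neq-sym x y with x ≟ y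
... | yes refl rewrite dec-true (y ≟ y) refl = refl
... | no x≢y rewrite dec-false (y ≟ x) (λ e → x≢y (sym e)) = refl

neq-refl : ∀ {n} (x : Fin n) → neq x x ≡ false
neq-refl x rewrite dec-true (x ≟ x) refl = refl

neq-true : ∀ {n} {x y : Fin n} → ¬ x ≡ y → neq x y ≡ true
neq-true {x = x} {y} x≢y rewrite dec-false (x ≟ y) x≢y = refl

<ᵇ-split : ∀ {n} (x y : Fin n) →
           indicator (toℕ x <ᵇ toℕ y) + indicator (toℕ y <ᵇ toℕ x) ≡ indicator (neq x y)
<ᵇ-split zero    zero    = refl
<ᵇ-split zero    (suc y) = refl
<ᵇ-split (suc x) zero    = refl
<ᵇ-split (suc x) (suc y) = <ᵇ-split x y

-- By symmetry of `F` the two strict orders of a pair contribute equally, and together they cover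
-- all pairs of distinct elements.
sum-pairs : ∀ n (F : Fin n → Fin n → ℕ) → (∀ x y → F x y ≡ F y x) →
  2 * sumFin n (λ x → sumFin n (λ y → indicator (toℕ x <ᵇ toℕ y) * F x y)) ≡
  sumFin n (λ x → sumFin n (λ y → indicator (neq x y) * F x y))
sum-pairs n F F-sym = begin
  2 * S                                         ≡⟨ cong (S +_) (+-identityʳ S) ⟩
  S + S                                         ≡⟨ cong (S +_) swapped ⟩
  S + sumFin n (λ x → sumFin n (λ y → lt y x * F x y)) ≡⟨ sym (sum-+ n _ _) ⟩
  sumFin n (λ x → sumFin n (λ y → lt x y * F x y) + sumFin n (λ y → lt y x * F x y))
    ≡⟨ sum-cong n (λ x → trans (sym (sum-+ n _ _)) (sum-cong n (λ y →
         trans (sym (*-distribʳ-+ (F x y) (lt x y) (lt y x))) (cong (_* F x y) (<ᵇ-split x y))))) ⟩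
  sumFin n (λ x → sumFin n (λ y → indicator (neq x y) * F x y)) ∎
  where
  open ≡-Reasoning
  lt : Fin n → Fin n → ℕ
  lt x y = indicator (toℕ x <ᵇ toℕ y)
  S : ℕ
  S = sumFin n (λ x → sumFin n (λ y → lt x y * F x y))
  swapped : S ≡ sumFin n (λ x → sumFin n (λ y → lt y x * F x y))
  swapped = trans (sum-swap n n _)
    (sum-cong n (λ x → sum-cong n (λ y → cong (lt y x *_) (F-sym y x))))

-- Ordered pairs of distinct elements, twice the binomial coefficient; this keeps halves out of the
-- counting.
pairs : ℕ → ℕ
pairs k = k * (k ∸ 1)

pairs+k : ∀ k → pairs k + k ≡ k * k
pairs+k zero    = refl
pairs+k (suc k) = identity k
  where
  identity : ∀ k → suc k * k + suc k ≡ suc k * suc k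
  identity = solve-∀

pairs-mono : ∀ {j k} → j ≤ k → pairs j ≤ pairs k
pairs-mono le = *-mono-≤ le (∸-monoˡ-≤ 1 le)

pairs-suc : ∀ k → pairs k + 2 * k ≡ pairs (suc k)
pairs-suc zero    = refl
pairs-suc (suc k) = identity k
  where
  identity : ∀ k → suc k * k + 2 * suc k ≡ suc (suc k) * suc k
  identity = solve-∀

-- The source of every linear loss: missing a single common neighbour already costs 2(k - 1).
pairs-gap : ∀ {j k} → j < k → pairs j + 2 * (k ∸ 1) ≤ pairs k
pairs-gap {j} {suc k} (s≤s j≤k) = ≤-trans (+-monoˡ-≤ (2 * k) (pairs-mono j≤k)) (≤-reflexive (pairs-suc k))

pairs≡2*C2 : ∀ k → 2 * (k C 2) ≡ pairs k
pairs≡2*C2 zero    = refl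
pairs≡2*C2 (suc k) = begin
  2 * (suc k C 2)         ≡⟨ cong (2 *_) (sym (nCk+nC[k+1]≡[n+1]C[k+1] k 1)) ⟩
  2 * (k C 1 + k C 2)     ≡⟨ *-distribˡ-+ 2 (k C 1) (k C 2) ⟩
  2 * (k C 1) + 2 * (k C 2) ≡⟨ cong₂ (λ a b → 2 * a + b) (nC1≡n k) (pairs≡2*C2 k) ⟩
  2 * k + pairs k         ≡⟨ trans (+-comm (2 * k) _) (pairs-suc k) ⟩
  pairs (suc k)           ∎
  where open ≡-Reasoning

-- Restoring the diagonal terms, which total `count f`, completes the double sum to the square of
-- `count f`.
sum-neq-pairs : ∀ {n} (f : Fin n → Bool) →
  sumFin n (λ x → sumFin n (λ y → indicator (neq x y) * (indicator (f x) * indicator (f y)))) ≡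
  pairs (count f)
sum-neq-pairs {n} f = +-cancelʳ-≡ (count f) _ _ (begin
  sumFin n (λ x → sumFin n (λ y → N x y * (I x * I y))) + count f ≡⟨ sym (sum-+ n _ _) ⟩
  sumFin n (λ x → sumFin n (λ y → N x y * (I x * I y)) + I x)     ≡⟨ sum-cong n row ⟩
  sumFin n (λ x → I x * count f)                                  ≡⟨ sum-*ʳ n (count f) I ⟩
  count f * count f                                               ≡⟨ sym (pairs+k (count f)) ⟩
  pairs (count f) + count f ∎)
  where
  open ≡-Reasoning
  I : Fin n → ℕ
  I x = indicator (f x)
  N : Fin n → Fin n → ℕ
  N x y = indicator (neq x y)
  idem : ∀ p → indicator p * indicator p ≡ indicator p
  idem true  = refl
  idem false = refl
  split : ∀ b k → indicator (not b) * k + indicator b * k ≡ k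
  split true  k = +-identityʳ k
  split false k = trans (+-identityʳ _) (+-identityʳ k)
  row : ∀ x → sumFin n (λ y → N x y * (I x * I y)) + I x ≡ I x * count f
  row x = begin
    sumFin n (λ y → N x y * (I x * I y)) + I x
      ≡⟨ cong (sumFin n (λ y → N x y * (I x * I y)) +_)
           (sym (trans (sum-delta n x (λ y → I x * I y)) (idem (f x)))) ⟩
    sumFin n (λ y → N x y * (I x * I y)) + sumFin n (λ y → indicator (does (x ≟ y)) * (I x * I y))
      ≡⟨ sym (sum-+ n _ _) ⟩
    sumFin n (λ y → N x y * (I x * I y) + indicator (does (x ≟ y)) * (I x * I y))
      ≡⟨ sum-cong n (λ y → split (does (x ≟ y)) (I x * I y)) ⟩
    sumFin n (λ y → I x * I y) ≡⟨ sum-*ˡ n (I x) I ⟩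
    I x * count f ∎

-- Red and blue neighbourhoods

<ᵇ-irrefl : ∀ k → (k <ᵇ k) ≡ false
<ᵇ-irrefl zero    = refl
<ᵇ-irrefl (suc k) = <ᵇ-irrefl k

module Graph {n : ℕ} (G : Colouring n) where

  col : Fin n → Fin n → Colour
  col = proj₁ G

  -- The colouring is arbitrary on the diagonal, so `neq` is built in to make both relations
  -- irreflexive.
  r b : Fin n → Fin n → Bool
  r x y = isRed (col x y) ∧ neq x y
  b x y = isBlue (col x y) ∧ neq x y

  r-sym : ∀ x y → r x y ≡ r y x
  r-sym x y = cong₂ (λ c e → isRed c ∧ e) (proj₂ G x y) (neq-sym x y)

  b-sym : ∀ x y → b x y ≡ b y x
  b-sym x y = cong₂ (λ c e → isBlue c ∧ e) (proj₂ G x y) (neq-sym x y)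

  r-swap : ∀ {x y} → r x y ≡ true → r y x ≡ true
  r-swap {x} {y} e = trans (r-sym y x) e

  r-irrefl : ∀ x → r x x ≡ false
  r-irrefl x = trans (cong (isRed (col x x) ∧_) (neq-refl x)) (∧-comm (isRed (col x x)) false)

  r-red : ∀ {x y} → r x y ≡ true → col x y ≡ red
  r-red {x} {y} e with col x y
  ... | red = refl

  red-r : ∀ {x y} → ¬ x ≡ y → col x y ≡ red → r x y ≡ true
  red-r {x} {y} x≢y e rewrite e = neq-true x≢y

  b⇒¬r : ∀ {x y} → b x y ≡ true → r x y ≡ false
  b⇒¬r {x} {y} e with col x y
  ... | blue = refl

  ¬r⇒b : ∀ {x y} → ¬ x ≡ y → r x y ≡ false → b x y ≡ true
  ¬r⇒b {x} {y} x≢y e with col x y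
  ... | red  = contradiction (trans (sym (neq-true x≢y)) e) λ ()
  ... | blue = neq-true x≢y

  ¬r⇒≡⊎b : ∀ {x y} → r x y ≡ false → x ≡ y ⊎ b x y ≡ true
  ¬r⇒≡⊎b {x} {y} e = case x ≟ y of λ where
    (yes x≡y) → inj₁ x≡y
    (no  x≢y) → inj₂ (¬r⇒b x≢y e)

  -- `size v` is the size of the class of `v`. The class contains `v` itself, hence exceeds the blue
  -- degree by one.
  deg bdeg size : Fin n → ℕ
  deg v  = count (r v)
  bdeg v = count (b v)
  size v = count (λ x → not (r v x))

  codeg : Fin n → Fin n → ℕ
  codeg u v = count (λ z → r u z ∧ r v z)

  codeg-sym : ∀ u v → codeg u v ≡ codeg v u
  codeg-sym u v = count-cong (λ z → ∧-comm (r u z) (r v z))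

  -- Twice the number of copies with `v` at an end of the blue chord: `pairs` takes the other two
  -- vertices in both orders.
  q : Fin n → ℕ
  q v = sumFin n (λ u → indicator (b v u) * pairs (codeg v u))

  deg+size : ∀ v → deg v + size v ≡ n
  deg+size v = count-not (r v)

  size≡ : ∀ v → size v ≡ suc (bdeg v)
  size≡ v = trans (trans (sum-cong n (λ x → h (col v x) (does (v ≟ x)) (diag x))) (sum-+ n _ _))
            (cong (_+ bdeg v) (sum-delta n v (λ _ → 1)))
    where
    diag : ∀ x → does (v ≟ x) ≡ not (neq v x)
    diag x with does (v ≟ x)
    ... | true = refl
    ... | false = refl
    h : ∀ c e → e ≡ not (not e) →
        indicator (not (isRed c ∧ not e)) ≡ indicator e * 1 + indicator (isBlue c ∧ not e)
    h red  true  _ = refl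
    h red  false _ = refl
    h blue true  _ = refl
    h blue false _ = refl

  deg+bdeg : ∀ v → suc (deg v + bdeg v) ≡ n
  deg+bdeg v = trans (sym (+-suc (deg v) (bdeg v))) (trans (cong (deg v +_) (sym (size≡ v))) (deg+size v))

  -- Counting copies by their blue chord

  isCopy-factor : ∀ a e c d → isCopy G a e c d ≡
    (toℕ a <ᵇ toℕ c) ∧ (b a c ∧ ((toℕ e <ᵇ toℕ d) ∧ ((r a e ∧ r c e) ∧ (r a d ∧ r c d))))
  isCopy-factor a e c d
    rewrite proj₂ G e c | proj₂ G d a with toℕ a <ᵇ toℕ c in lt
  ... | false = refl
  -- `b a c` also demands that `a` and `c` differ, which follows from `toℕ a <ᵇ toℕ c`; the
  -- remaining ten conjuncts are only rearranged.
  ... | true rewrite neq-true {x = a} {c} (λ { refl → true≢false lt (<ᵇ-irrefl (toℕ a)) }) =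
    solve-∧ 10 (λ p n₁ n₂ n₃ n₄ bl r₁ r₂ r₃ r₄ →
      (p ⊕ (n₁ ⊕ (n₂ ⊕ (n₃ ⊕ (n₄ ⊕ (bl ⊕ (r₁ ⊕ (r₂ ⊕ (r₃ ⊕ r₄))))))))) ⊜
      ((bl ⊕ id) ⊕ (p ⊕ (((r₁ ⊕ n₁) ⊕ (r₂ ⊕ n₃)) ⊕ ((r₄ ⊕ n₂) ⊕ (r₃ ⊕ n₄))))))
      refl (toℕ e <ᵇ toℕ d) (neq a e) (neq a d) (neq c e) (neq c d)
           (isBlue (col a c)) (isRed (col a e)) (isRed (col c e)) (isRed (col c d)) (isRed (col a d))

  -- Each copy is found from both ends of its chord and with its other two vertices in both orders,
  -- hence the factor 2 · 2.
  4*copiesH : 4 * copiesH G ≡ sumFin n q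
  4*copiesH = begin
    4 * copiesH G         ≡⟨ *-assoc 2 2 (copiesH G) ⟩
    2 * (2 * copiesH G)   ≡⟨ cong (2 *_) twice ⟩
    2 * sumFin n (λ a → sumFin n (λ c → lt a c * (B a c * pairs (codeg a c))))
      ≡⟨ sum-pairs n (λ a c → B a c * pairs (codeg a c))
           (λ a c → cong₂ (λ e k → indicator e * pairs k) (b-sym a c) (codeg-sym a c)) ⟩
    sumFin n (λ a → sumFin n (λ c → indicator (neq a c) * (B a c * pairs (codeg a c))))
      ≡⟨ sum-cong n (λ a → sum-cong n (λ c → trans (sym (*-assoc (indicator (neq a c)) (B a c) _)) (cong (_* pairs (codeg a c)) (absorb (isBlue (col a c)) (neq a c))))) ⟩
    sumFin n q ∎
    where
    open ≡-Reasoning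
    lt B : Fin n → Fin n → ℕ
    lt x y = indicator (toℕ x <ᵇ toℕ y)
    B x y = indicator (b x y)
    absorb : ∀ e f → indicator f * indicator (e ∧ f) ≡ indicator (e ∧ f)
    absorb true  true  = refl
    absorb true  false = refl
    absorb false true  = refl
    absorb false false = refl
    common : Fin n → Fin n → Fin n → ℕ
    common a c z = indicator (r a z ∧ r c z)
    term : ∀ a e c d → indicator (isCopy G a e c d) ≡
           lt a c * (B a c * (lt e d * (common a c e * common a c d)))
    term a e c d = trans (cong indicator (isCopy-factor a e c d))
      (trans (indicator-∧ (toℕ a <ᵇ toℕ c) _) (cong (lt a c *_)
      (trans (indicator-∧ (b a c) _) (cong (B a c *_)
      (trans (indicator-∧ (toℕ e <ᵇ toℕ d) _) (cong (lt e d *_)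
      (indicator-∧ (r a e ∧ r c e) _)))))))
    inner : Fin n → Fin n → ℕ
    inner a c = sumFin n (λ e → sumFin n (λ d → lt e d * (common a c e * common a c d)))
    pull : ∀ k l (F : Fin n → Fin n → ℕ) →
           sumFin n (λ x → sumFin n (λ y → k * (l * F x y))) ≡ k * (l * sumFin n (λ x → sumFin n (F x)))
    pull k l F = trans (sum-cong n (λ x → trans (sum-*ˡ n k _) (cong (k *_) (sum-*ˡ n l _))))
                 (trans (sum-*ˡ n k _) (cong (k *_) (sum-*ˡ n l _)))
    2*inner : ∀ a c → 2 * inner a c ≡ pairs (codeg a c)
    2*inner a c = trans (sum-pairs n (λ x y → common a c x * common a c y)
                    (λ x y → *-comm (common a c x) (common a c y)))
                  (sum-neq-pairs (λ z → r a z ∧ r c z))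
    -- Exchanging the two middle sums moves the chord outside; for a fixed chord, pairs of common
    -- red neighbours remain to be counted.
    once : copiesH G ≡ sumFin n (λ a → sumFin n (λ c → lt a c * (B a c * inner a c)))
    once = sum-cong n (λ a → trans (sum-swap n n _) (sum-cong n (λ c →
             trans (sum-cong n (λ e → sum-cong n (λ d → term a e c d))) (pull (lt a c) (B a c) _))))
    double : ∀ k l m → 2 * (k * (l * m)) ≡ k * (l * (2 * m))
    double = solve-∀
    twice : 2 * copiesH G ≡ sumFin n (λ a → sumFin n (λ c → lt a c * (B a c * pairs (codeg a c))))
    twice = trans (cong (2 *_) once) (trans (sym (sum-*ˡ n 2 _)) (sum-cong n (λ a →
              trans (sym (sum-*ˡ n 2 _)) (sum-cong n (λ c →
                trans (double (lt a c) (B a c) (inner a c)) (cong (λ k → lt a c * (B a c * k)) (2*inner a c)))))))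

  -- Closed vertices and the loss at a vertex that is not closed

  Closed : Fin n → Set
  Closed v = ∀ u → b v u ≡ true → ∀ z → r v z ≡ true → r u z ≡ true

  ∧-true : ∀ e {f} → e ∧ f ≡ true → e ≡ true × f ≡ true
  ∧-true true e = refl , e

  codeg≤deg : ∀ v u → codeg v u ≤ deg v
  codeg≤deg v u = count-mono {f = λ z → r v z ∧ r u z} (λ z e → proj₁ (∧-true (r v z) e))

  q≤ : ∀ v → q v ≤ bdeg v * pairs (deg v)
  q≤ v = ≤-trans (sum-mono n (λ u → *-monoʳ-≤ (indicator (b v u)) (pairs-mono (codeg≤deg v u))))
         (≤-reflexive (sum-*ʳ n _ _))

  closed-q : ∀ {v} → Closed v → q v ≡ bdeg v * pairs (deg v)
  closed-q {v} cl = trans (sum-cong n term) (sum-*ʳ n _ _)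
    where
    term : ∀ u → indicator (b v u) * pairs (codeg v u) ≡ indicator (b v u) * pairs (deg v)
    term u with b v u in e
    ... | false = refl
    ... | true  = cong (λ k → 1 * pairs k) (≤-antisym (codeg≤deg v u)
                    (count-mono (λ z rvz → cong₂ _∧_ rvz (cl u e z rvz))))

  -- Closedness is a finite condition, so its failure comes with a concrete blue neighbour `u` that
  -- misses a red neighbour `z` of `v`.
  closed? : ∀ v → Closed v ⊎ ∃ λ u → b v u ≡ true × ∃ λ z → r v z ≡ true × r u z ≡ false
  closed? v with any? (λ u → (b v u ≟ᵇ true) ×-dec any? (λ z → (r v z ≟ᵇ true) ×-dec (r u z ≟ᵇ false)))
  ... | yes w = inj₂ w
  ... | no ¬w = inj₁ λ u bvu z rvz → h u bvu z rvz
    where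
    h : ∀ u → b v u ≡ true → ∀ z → r v z ≡ true → r u z ≡ true
    h u bvu z rvz with r u z in e
    ... | true  = refl
    ... | false = contradiction (u , bvu , z , rvz , e) ¬w

  -- If `u` misses the red neighbour `z` of `v`, then `codeg v u` is below `deg v`, and by
  -- `pairs-gap` the term of `u` alone falls short by 2(deg v - 1). The delta sum books this loss at
  -- `u`.
  closed⊎gap : ∀ v → Closed v ⊎ q v + 2 * (deg v ∸ 1) ≤ bdeg v * pairs (deg v)
  closed⊎gap v with closed? v
  ... | inj₁ cl = inj₁ cl
  ... | inj₂ (u , bvu , z , rvz , ruz) = inj₂ (begin
    q v + gap                                                 ≡⟨ cong (q v +_) (sym (sum-delta n u (λ _ → gap))) ⟩
    q v + sumFin n (λ w → indicator (does (u ≟ w)) * gap)     ≡⟨ sym (sum-+ n _ _) ⟩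
    sumFin n (λ w → indicator (b v w) * pairs (codeg v w) + indicator (does (u ≟ w)) * gap)
      ≤⟨ sum-mono n term ⟩
    sumFin n (λ w → indicator (b v w) * pairs (deg v))        ≡⟨ sum-*ʳ n _ _ ⟩
    bdeg v * pairs (deg v)                                    ∎)
    where
    open ≤-Reasoning
    gap : ℕ
    gap = 2 * (deg v ∸ 1)
    codeg<deg : codeg v u < deg v
    codeg<deg = count-mono-< {f = λ z → r v z ∧ r u z} (λ z e → proj₁ (∧-true (r v z) e)) z (cong₂ _∧_ rvz ruz) rvz
    term : ∀ w → indicator (b v w) * pairs (codeg v w) + indicator (does (u ≟ w)) * gap ≤
                 indicator (b v w) * pairs (deg v)
    term w with u ≟ w
    ... | no _ = ≤-trans (≤-reflexive (+-identityʳ _)) (*-monoʳ-≤ (indicator (b v w)) (pairs-mono (codeg≤deg v w)))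
    ... | yes refl rewrite bvu = ≤-trans (≤-reflexive (cong₂ _+_ (+-identityʳ (pairs (codeg v u))) (+-identityʳ gap)))
                                 (≤-trans (pairs-gap codeg<deg) (≤-reflexive (sym (+-identityʳ _))))

  -- Classes of closed vertices

  closed-class : ∀ {v x y} → Closed v → r v x ≡ false → r v y ≡ true → r x y ≡ true
  closed-class {v} {x} cl rvx rvy with ¬r⇒≡⊎b rvx
  ... | inj₁ refl = rvy
  ... | inj₂ bvx  = cl x bvx _ rvy

  not-true : ∀ {e} → not e ≡ true → e ≡ false
  not-true {false} _ = refl

  classes-disjoint : ∀ {v w x} → Closed v → r v w ≡ true → r v x ≡ false → r w x ≡ true
  classes-disjoint clv rvw rvx = r-swap (closed-class clv rvx rvw)

  outside : Fin n → Fin n → Fin n → Bool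
  outside v w x = r v x ∧ r w x

  -- The two classes are disjoint, so every vertex lies in exactly one of them or outside both.
  count-outside : ∀ {v w} → Closed v → r v w ≡ true → count (outside v w) + (size v + size w) ≡ n
  count-outside {v} {w} clv rvw = begin
    count (outside v w) + (size v + size w) ≡⟨ cong (count (outside v w) +_) (sym (sum-+ n _ _)) ⟩
    count (outside v w) + sumFin n (λ x → indicator (not (r v x)) + indicator (not (r w x)))
      ≡⟨ sym (sum-+ n _ _) ⟩
    sumFin n (λ x → indicator (r v x ∧ r w x) + (indicator (not (r v x)) + indicator (not (r w x))))
      ≡⟨ sum-cong n (λ x → h (r v x) (r w x) (classes-disjoint clv rvw)) ⟩
    sumFin n (λ _ → 1) ≡⟨ trans (sum-const n 1) (*-identityʳ n) ⟩
    n ∎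
    where
    open ≡-Reasoning
    h : ∀ e f → (e ≡ false → f ≡ true) →
        indicator (e ∧ f) + (indicator (not e) + indicator (not f)) ≡ 1
    h true  true  _ = refl
    h true  false _ = refl
    h false true  _ = refl
    h false false k = contradiction (k refl) λ ()

  -- A vertex outside both classes is joined in red to every element of each, and the classes are
  -- disjoint.
  deg-outside : ∀ {v w x} → Closed v → Closed w → r v w ≡ true → outside v w x ≡ true →
                size v + size w ≤ deg x
  deg-outside {v} {w} {x} clv clw rvw ox = ≤-trans (≤-reflexive (sym (sum-+ n _ _)))
    (sum-mono n (λ z → h (r v z) (r w z) (r x z) (classes-disjoint clv rvw)
      (λ e → r-swap (closed-class clv e rvx)) (λ e → r-swap (closed-class clw e rwx))))
    where
    rvx : r v x ≡ true
    rvx = proj₁ (∧-true (r v x) ox)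
    rwx : r w x ≡ true
    rwx = proj₂ (∧-true (r v x) ox)
    h : ∀ e f g → (e ≡ false → f ≡ true) → (e ≡ false → g ≡ true) → (f ≡ false → g ≡ true) →
        indicator (not e) + indicator (not f) ≤ indicator g
    h true  true  g _ _ _ = z≤n
    h true  false g _ _ k rewrite k refl = ≤-refl
    h false true  g _ k _ rewrite k refl = ≤-refl
    h false false g k _ _ = contradiction (k refl) λ ()

  class⊆outside : ∀ {u v w} → Closed u → Closed v → r u w ≡ true → r v w ≡ true →
                  ∀ x → not (r w x) ≡ true → outside u v x ≡ true
  class⊆outside {u} {v} {w} clu clv ruw rvw x e = cong₂ _∧_ (h clu ruw) (h clv rvw)
    where
    h : ∀ {v} → Closed v → r v w ≡ true → r v x ≡ true
    h {v} cl rvw with r v x in rvx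
    ... | true  = refl
    ... | false = ⊥-elim (true≢false (classes-disjoint cl rvw rvx) (not-true e))

  -- The class of `w` lies outside the disjoint classes of `u` and `v`, so the three sizes add up
  -- inside the vertex set.
  three-classes : ∀ {u v w} → Closed u → Closed v → r u v ≡ true → r u w ≡ true → r v w ≡ true →
                  size w + (size u + size v) ≤ n
  three-classes clu clv ruv ruw rvw = ≤-trans (+-monoˡ-≤ _ (count-mono (class⊆outside clu clv ruw rvw)))
                                      (≤-reflexive (count-outside clu ruv))

  -- What the equality case delivers: one representative for each part of the Turán graph.
  record Triangle (n₁ n₂ n₃ : ℕ) : Set where
    field
      closed : ∀ v → Closed v
      v₁ v₂ v₃ : Fin n
      r₁₂ : r v₁ v₂ ≡ true
      r₁₃ : r v₁ v₃ ≡ true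
      r₂₃ : r v₂ v₃ ≡ true
      size₁ : size v₁ ≡ n₁
      size₂ : size v₂ ≡ n₂
      size₃ : size v₃ ≡ n₃

  -- The parts are the classes of the three representatives. These are disjoint and their sizes sum
  -- to `n`, so they partition the vertices.
  triangle⇒tripartite : ∀ {n₁ n₂ n₃} → n₁ + n₂ + n₃ ≡ n → Triangle n₁ n₂ n₃ →
                        RedIsCompleteTripartite G n₁ n₂ n₃
  triangle⇒tripartite {n₁} {n₂} {n₃} sum-n T =
    p , trans (count-cong part₁) size₁ , trans (count-cong part₂) size₂ ,
    trans (count-cong part₃) size₃ , adjacency
    where
    open Triangle T
    part : Bool → Bool → Fin 3
    part false _     = zero
    part true  false = suc zero
    part true  true  = suc (suc zero)
    p : Fin n → Fin 3
    p x = part (r v₁ x) (r v₂ x)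
    part₁ : ∀ x → does (p x ≟ zero) ≡ not (r v₁ x)
    part₁ x with r v₁ x | r v₂ x
    ... | false | _     = refl
    ... | true  | false = refl
    ... | true  | true  = refl
    part₂ : ∀ x → does (p x ≟ suc zero) ≡ not (r v₂ x)
    part₂ x with r v₁ x in e | r v₂ x in f
    ... | false | true  = refl
    ... | false | false = ⊥-elim (true≢false (classes-disjoint (closed v₁) r₁₂ e) f)
    ... | true  | false = refl
    ... | true  | true  = refl
    -- The class of `v₃` lies outside the other two; the sizes turn this inclusion into equality.
    class₃ : ∀ x → not (r v₃ x) ≡ outside v₁ v₂ x
    class₃ = count-mono-tight (class⊆outside (closed v₁) (closed v₂) r₁₃ r₂₃)
      (trans size₃ (+-cancelʳ-≡ (n₁ + n₂) _ _ (trans (+-comm n₃ (n₁ + n₂))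
        (trans sum-n (trans (sym (count-outside (closed v₁) r₁₂))
          (cong (count (outside v₁ v₂) +_) (cong₂ _+_ size₁ size₂)))))))
    part₃ : ∀ x → does (p x ≟ suc (suc zero)) ≡ not (r v₃ x)
    part₃ x rewrite class₃ x with r v₁ x | r v₂ x
    ... | false | _     = refl
    ... | true  | false = refl
    ... | true  | true  = refl
    rep : Fin 3 → Fin n
    rep zero             = v₁
    rep (suc zero)       = v₂
    rep (suc (suc zero)) = v₃
    class : ∀ i x → does (p x ≟ i) ≡ not (r (rep i) x)
    class zero             = part₁
    class (suc zero)       = part₂
    class (suc (suc zero)) = part₃
    in-class : ∀ {i x} → p x ≡ i → r (rep i) x ≡ false
    in-class {i} {x} e with p x ≟ i | class i x
    ... | yes _ | k = not-true (sym k)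
    ... | no ne | _ = contradiction e ne
    off-class : ∀ {i x} → ¬ p x ≡ i → r (rep i) x ≡ true
    off-class {i} {x} ne with p x ≟ i | class i x
    ... | yes e | _ = contradiction e ne
    ... | no _  | k = not-injective (sym k)
    -- If `x` is not `v`, then `v` is a blue neighbour of `x`; a red edge from `x` to `y` would make
    -- `v y` red because `x` is closed.
    same-class⇒¬r : ∀ {v x y} → r v x ≡ false → r v y ≡ false → ¬ r x y ≡ true
    same-class⇒¬r {v} {x} {y} rvx rvy rxy with ¬r⇒≡⊎b rvx
    ... | inj₁ refl = true≢false rxy rvy
    ... | inj₂ bvx  = true≢false (closed x v (trans (b-sym x v) bvx) y rxy) rvy
    adjacency : ∀ x y → ¬ x ≡ y → (col x y ≡ red) ⇔ (¬ p x ≡ p y)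
    adjacency x y x≢y = mk⇔ (λ c e → same-class⇒¬r (in-class refl) (in-class (sym e)) (red-r x≢y c))
      (λ ne → r-red (closed-class (closed (rep (p x))) (in-class refl) (off-class (λ e → ne (sym e)))))

  -- The count for a complete tripartite colouring

  sum-parts : (p : Fin n → Fin 3) (F : Fin 3 → ℕ) → sumFin n (λ x → F (p x)) ≡
              partSize p zero * F zero + partSize p (suc zero) * F (suc zero) +
              partSize p (suc (suc zero)) * F (suc (suc zero))
  sum-parts p F = trans (sum-cong n (λ x → h (p x)))
    (trans (sum-+ n _ _) (cong₂ _+_ (trans (sum-+ n _ _) (cong₂ _+_ (sum-*ʳ n _ _) (sum-*ʳ n _ _))) (sum-*ʳ n _ _)))
    where
    h : ∀ i → F i ≡ indicator (does (i ≟ zero)) * F zero + indicator (does (i ≟ suc zero)) * F (suc zero) +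
                    indicator (does (i ≟ suc (suc zero))) * F (suc (suc zero))
    h zero             = sym (trans (+-identityʳ _) (trans (+-identityʳ _) (+-identityʳ _)))
    h (suc zero)       = sym (trans (+-identityʳ _) (+-identityʳ _))
    h (suc (suc zero)) = sym (+-identityʳ _)

  -- Every vertex is closed with its part as class, so `q` attains its upper bound everywhere and
  -- depends only on the part.
  tripartite-sum : ∀ {n₁ n₂ n₃} → RedIsCompleteTripartite G n₁ n₂ n₃ →
    sumFin n q ≡ pairs n₁ * pairs (n ∸ n₁) + pairs n₂ * pairs (n ∸ n₂) + pairs n₃ * pairs (n ∸ n₃)
  tripartite-sum (p , refl , refl , refl , adj) =
    trans (sum-cong n q-part) (trans (sum-parts p F) (cong₂ _+_ (cong₂ _+_ (assoc zero) (assoc (suc zero))) (assoc (suc (suc zero)))))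
    where
    F : Fin 3 → ℕ
    F i = (partSize p i ∸ 1) * pairs (n ∸ partSize p i)
    assoc : ∀ i → partSize p i * F i ≡ pairs (partSize p i) * pairs (n ∸ partSize p i)
    assoc i = sym (*-assoc (partSize p i) _ _)
    r⇒≢ : ∀ {x y} → r x y ≡ true → ¬ p x ≡ p y
    r⇒≢ {x} {y} e = Equivalence.to (adj x y (λ { refl → true≢false e (r-irrefl x) })) (r-red e)
    ≢⇒r : ∀ {x y} → ¬ p x ≡ p y → r x y ≡ true
    ≢⇒r {x} {y} ne = red-r (λ e → ne (cong p e)) (Equivalence.from (adj x y (λ e → ne (cong p e))) ne)
    same : ∀ v x → not (r v x) ≡ does (p x ≟ p v)
    same v x with p x ≟ p v | r v x in e
    ... | yes k | true  = contradiction (sym k) (r⇒≢ e)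
    ... | yes k | false = refl
    ... | no ¬k | true  = refl
    ... | no ¬k | false = ⊥-elim (true≢false (≢⇒r (λ k → ¬k (sym k))) e)
    size-part : ∀ v → size v ≡ partSize p (p v)
    size-part v = count-cong (same v)
    deg-part : ∀ v → deg v ≡ n ∸ partSize p (p v)
    deg-part v = trans (sym (m+n∸n≡m (deg v) (size v))) (cong₂ _∸_ (deg+size v) (size-part v))
    closed : ∀ v → Closed v
    closed v u bvu z rvz = ≢⇒r λ puz → r⇒≢ rvz (trans pvu puz)
      where
      pvu : p v ≡ p u
      pvu with p v ≟ p u
      ... | yes e = e
      ... | no ne = ⊥-elim (true≢false (≢⇒r ne) (b⇒¬r bvu))
    q-part : ∀ v → q v ≡ F (p v)
    q-part v = trans (closed-q (closed v)) (cong₂ (λ s d → s * pairs d)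
      (trans (cong (_∸ 1) (sym (size≡ v))) (cong (_∸ 1) (size-part v))) (deg-part v))

-- The degree profile

-- c is the blue and d the red degree of a vertex.
profile : ℕ → ℕ → ℕ
profile c d = c * pairs d

private
  swap-factor : ∀ c e f → c * (suc e * f) ≡ suc e * (c * f)
  swap-factor = solve-∀

  suc*-two : ∀ c e → c * e + 2 * c ≡ c * (2 + e)
  suc*-two = solve-∀

-- For positive d, cancelling the factor d leaves (c + 1)(d - 1) ≤ c(d + 1), that is d ≤ 2c + 1.
-- `profile-down` is the reverse comparison.
profile-up : ∀ c d → d ≤ 1 + 2 * c → profile (suc c) d ≤ profile c (suc d)
profile-up c zero    le = ≤-reflexive (trans (*-zeroʳ c) (sym (*-zeroʳ c)))
profile-up c (suc e) (s≤s e≤2c) = begin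
  suc c * (suc e * e)       ≡⟨ swap-factor (suc c) e e ⟩
  suc e * (e + c * e)       ≤⟨ *-monoʳ-≤ (suc e) (≤-trans (≤-reflexive (+-comm e (c * e))) (+-monoʳ-≤ (c * e) e≤2c)) ⟩
  suc e * (c * e + 2 * c)   ≡⟨ cong (suc e *_) (suc*-two c e) ⟩
  suc e * (c * (2 + e))     ≡⟨ swap-factor c e (2 + e) ⟨
  c * (suc e * (2 + e))     ≡⟨ cong (c *_) (*-comm (suc e) (2 + e)) ⟩
  c * ((2 + e) * suc e)     ∎
  where open ≤-Reasoning

profile-down : ∀ c d → 1 + 2 * c ≤ d → profile c (suc d) ≤ profile (suc c) d
profile-down c (suc e) (s≤s 2c≤e) = begin
  c * ((2 + e) * suc e)     ≡⟨ cong (c *_) (*-comm (suc e) (2 + e)) ⟨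
  c * (suc e * (2 + e))     ≡⟨ swap-factor c e (2 + e) ⟩
  suc e * (c * (2 + e))     ≡⟨ cong (suc e *_) (suc*-two c e) ⟨
  suc e * (c * e + 2 * c)   ≤⟨ *-monoʳ-≤ (suc e) (≤-trans (+-monoʳ-≤ (c * e) 2c≤e) (≤-reflexive (+-comm (c * e) e))) ⟩
  suc e * (e + c * e)       ≡⟨ swap-factor (suc c) e e ⟨
  suc c * (suc e * e)       ∎
  where open ≤-Reasoning

-- Iterates `profile-up`; the hypothesis is the condition for the last step, which is the most
-- demanding one. The same holds for `profile-descend` and `profile-down`.
profile-ascend : ∀ j c d → d + j ≤ 2 + 2 * c → profile (j + c) d ≤ profile c (j + d)
profile-ascend zero    c d le = ≤-refl
profile-ascend (suc j) c d le = begin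
  profile (suc (j + c)) d ≤⟨ profile-up (j + c) d (≤-trans (m≤m+n d j) (≤-trans d+j≤ (s≤s (*-monoʳ-≤ 2 (m≤n+m c j))))) ⟩
  profile (j + c) (suc d) ≤⟨ profile-ascend j c (suc d) (s≤s d+j≤) ⟩
  profile c (j + suc d)   ≡⟨ cong (profile c) (+-suc j d) ⟩
  profile c (suc j + d)   ∎
  where
  open ≤-Reasoning
  d+j≤ : d + j ≤ 1 + 2 * c
  d+j≤ = ≤-pred (≤-trans (≤-reflexive (sym (+-suc d j))) le)

profile-descend : ∀ j c d → 2 * (c + j) ≤ 1 + d → profile c (j + d) ≤ profile (j + c) d
profile-descend zero    c d le = ≤-refl
profile-descend (suc j) c d le = begin
  profile c (suc j + d)   ≡⟨ cong (profile c) (+-suc j d) ⟨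
  profile c (j + suc d)   ≤⟨ profile-descend j c (suc d) (≤-trans (*-monoʳ-≤ 2 (+-monoʳ-≤ c (n≤1+n j))) (≤-trans le (n≤1+n _))) ⟩
  profile (j + c) (suc d) ≤⟨ profile-down (j + c) d (≤-pred (≤-trans (≤-reflexive (shift c j)) le)) ⟩
  profile (suc j + c) d   ∎
  where
  open ≤-Reasoning
  shift : ∀ c j → 2 + 2 * (j + c) ≡ 2 * (c + suc j)
  shift = solve-∀

profile-below : ∀ {c d} c₀ d₀ → c + d ≡ c₀ + d₀ → d ≤ d₀ → d₀ ≤ 2 + 2 * c₀ → profile c d ≤ profile c₀ d₀
profile-below {c} {d} c₀ d₀ e d≤d₀ bound = begin
  profile c d           ≡⟨ cong (λ x → profile x d) (+-cancelʳ-≡ d _ _ (trans e (trans (cong (c₀ +_) (sym j+d)) (shuffle c₀ j d)))) ⟩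
  profile (j + c₀) d    ≤⟨ profile-ascend j c₀ d (≤-trans (≤-reflexive (trans (+-comm d j) j+d)) bound) ⟩
  profile c₀ (j + d)    ≡⟨ cong (profile c₀) j+d ⟩
  profile c₀ d₀         ∎
  where
  open ≤-Reasoning
  j : ℕ
  j = d₀ ∸ d
  j+d : j + d ≡ d₀
  j+d = m∸n+n≡m d≤d₀
  shuffle : ∀ c j d → c + (j + d) ≡ j + c + d
  shuffle = solve-∀

profile-above : ∀ {c d} c₀ d₀ → c + d ≡ c₀ + d₀ → d₀ ≤ d → 2 * c₀ ≤ 1 + d₀ → profile c d ≤ profile c₀ d₀
profile-above {c} {d} c₀ d₀ e d₀≤d bound = begin
  profile c d           ≡⟨ cong (profile c) (sym j+d₀) ⟩
  profile c (j + d₀)    ≤⟨ profile-descend j c d₀ (≤-trans (≤-reflexive (cong (2 *_) c+j)) bound) ⟩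
  profile (j + c) d₀    ≡⟨ cong (λ x → profile x d₀) (trans (+-comm j c) c+j) ⟩
  profile c₀ d₀         ∎
  where
  open ≤-Reasoning
  j : ℕ
  j = d ∸ d₀
  j+d₀ : j + d₀ ≡ d
  j+d₀ = m∸n+n≡m d₀≤d
  c+j : c + j ≡ c₀
  c+j = +-cancelʳ-≡ d₀ _ _ (trans (+-assoc c j d₀) (trans (cong (c +_) j+d₀) e))

profile-at : ∀ {c d} c₀ d₀ → c + d ≡ c₀ + d₀ → d ≡ d₀ → profile c d ≡ profile c₀ d₀
profile-at {c} c₀ d₀ e refl = cong (λ x → profile x d₀) (+-cancelʳ-≡ d₀ c c₀ e)

-- Around the peak, for c + d = 3m − 1, 3m, 3m + 1 with m = k + 3.

profile-zones₀ : ∀ k {c d M} → c + d ≡ 8 + 3 * k → profile (2 + k) (6 + 2 * k) ≡ M →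
  (d ≡ 6 + 2 * k × profile c d ≡ M) ⊎
  (d ≡ 5 + 2 * k × profile c d ≡ M) ⊎
  (profile c d < M)
profile-zones₀ k {c} {d} e refl with <-cmp d (5 + 2 * k)
... | tri≈ _ d≡ _ = inj₂ (inj₁ (d≡ , trans (profile-at (3 + k) (5 + 2 * k) (trans e (total k)) d≡) (value k)))
  where
  total : ∀ k → 8 + 3 * k ≡ 3 + k + (5 + 2 * k)
  total = solve-∀
  value : ∀ k → (3 + k) * ((5 + 2 * k) * (4 + 2 * k)) ≡ (2 + k) * ((6 + 2 * k) * (5 + 2 * k))
  value = solve-∀
-- The profile rises towards the peaks, so all smaller degrees are controlled by the value at 2m -
-- 2; larger ones are later controlled by the value at 2m + 1.
... | tri< (s≤s d≤) _ _ = inj₂ (inj₂ (≤-trans (s≤s (profile-below (4 + k) (4 + 2 * k) (trans e (total k)) d≤ (slack 6 (bound k))))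
                    (slack (11 + 6 * k) (value k))))
  where
  total : ∀ k → 8 + 3 * k ≡ 4 + k + (4 + 2 * k)
  total = solve-∀
  bound : ∀ k → 4 + 2 * k + 6 ≡ 2 + 2 * (4 + k)
  bound = solve-∀
  value : ∀ k → suc ((4 + k) * ((4 + 2 * k) * (3 + 2 * k))) + (11 + 6 * k) ≡ (2 + k) * ((6 + 2 * k) * (5 + 2 * k))
  value = solve-∀
... | tri> _ _ 6≤d with m≤n⇒m<n∨m≡n 6≤d
...   | inj₂ d≡ = inj₁ (sym d≡ , profile-at (2 + k) (6 + 2 * k) (trans e (total k)) (sym d≡))
  where
  total : ∀ k → 8 + 3 * k ≡ 2 + k + (6 + 2 * k)
  total = solve-∀
...   | inj₁ 7≤d = inj₂ (inj₂ (≤-trans (s≤s (profile-above (1 + k) (7 + 2 * k) (trans e (total k)) 7≤d (slack 6 (bound k))))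
                    (slack (17 + 6 * k) (value k))))
  where
  total : ∀ k → 8 + 3 * k ≡ 1 + k + (7 + 2 * k)
  total = solve-∀
  bound : ∀ k → 2 * (1 + k) + 6 ≡ 1 + (7 + 2 * k)
  bound = solve-∀
  value : ∀ k → suc ((1 + k) * ((7 + 2 * k) * (6 + 2 * k))) + (17 + 6 * k) ≡ (2 + k) * ((6 + 2 * k) * (5 + 2 * k))
  value = solve-∀

-- The peak is d = 2m. The losses are 2m at 2m + 1, at least 4m - 2 below the peak, and at least 10m
-- + 4 from 2m + 2 on.
profile-zones₁ : ∀ k {c d M} → c + d ≡ 9 + 3 * k → profile (3 + k) (6 + 2 * k) ≡ M →
  (d ≡ 6 + 2 * k × profile c d ≡ M) ⊎
  (d ≡ 7 + 2 * k × profile c d + (6 + 2 * k) ≡ M) ⊎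
  (d ≤ 5 + 2 * k × profile c d + (10 + 4 * k) ≤ M) ⊎
  (profile c d + (34 + 10 * k) ≤ M)
profile-zones₁ k {c} {d} e refl with <-cmp d (6 + 2 * k)
... | tri≈ _ d≡ _ = inj₁ (d≡ , profile-at (3 + k) (6 + 2 * k) (trans e (total k)) d≡)
  where
  total : ∀ k → 9 + 3 * k ≡ 3 + k + (6 + 2 * k)
  total = solve-∀
... | tri< (s≤s d≤) _ _ = inj₂ (inj₂ (inj₁ (d≤ , ≤-trans
    (+-monoˡ-≤ _ (profile-below (4 + k) (5 + 2 * k) (trans e (total k)) d≤ (slack 5 (bound k))))
    (≤-reflexive (value k)))))
  where
  total : ∀ k → 9 + 3 * k ≡ 4 + k + (5 + 2 * k)
  total = solve-∀
  bound : ∀ k → 5 + 2 * k + 5 ≡ 2 + 2 * (4 + k)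
  bound = solve-∀
  value : ∀ k → (4 + k) * ((5 + 2 * k) * (4 + 2 * k)) + (10 + 4 * k) ≡ (3 + k) * ((6 + 2 * k) * (5 + 2 * k))
  value = solve-∀
... | tri> _ _ 7≤d with m≤n⇒m<n∨m≡n 7≤d
...   | inj₂ d≡ = inj₂ (inj₁ (sym d≡ ,
    trans (cong (_+ (6 + 2 * k)) (profile-at (2 + k) (7 + 2 * k) (trans e (total k)) (sym d≡))) (value k)))
  where
  total : ∀ k → 9 + 3 * k ≡ 2 + k + (7 + 2 * k)
  total = solve-∀
  value : ∀ k → (2 + k) * ((7 + 2 * k) * (6 + 2 * k)) + (6 + 2 * k) ≡ (3 + k) * ((6 + 2 * k) * (5 + 2 * k))
  value = solve-∀
...   | inj₁ 8≤d = inj₂ (inj₂ (inj₂ (≤-trans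
    (+-monoˡ-≤ _ (profile-above (1 + k) (8 + 2 * k) (trans e (total k)) 8≤d (slack 7 (bound k))))
    (≤-reflexive (value k)))))
  where
  total : ∀ k → 9 + 3 * k ≡ 1 + k + (8 + 2 * k)
  total = solve-∀
  bound : ∀ k → 2 * (1 + k) + 7 ≡ 1 + (8 + 2 * k)
  bound = solve-∀
  value : ∀ k → (1 + k) * ((8 + 2 * k) * (7 + 2 * k)) + (34 + 10 * k) ≡ (3 + k) * ((6 + 2 * k) * (5 + 2 * k))
  value = solve-∀

-- The peak is d = 2m + 1. The losses are 2m at 2m and 4m + 2 at 2m + 2; the bound 4m + 3 elsewhere
-- is chosen just above the latter.
profile-zones₂ : ∀ k {c d M} → c + d ≡ 10 + 3 * k → profile (3 + k) (7 + 2 * k) ≡ M →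
  (d ≡ 7 + 2 * k × profile c d ≡ M) ⊎
  (d ≡ 6 + 2 * k × profile c d + (6 + 2 * k) ≡ M) ⊎
  (d ≡ 8 + 2 * k × profile c d + (14 + 4 * k) ≡ M) ⊎
  (profile c d + (15 + 4 * k) ≤ M)
profile-zones₂ k {c} {d} e refl with <-cmp d (7 + 2 * k)
... | tri≈ _ d≡ _ = inj₁ (d≡ , profile-at (3 + k) (7 + 2 * k) (trans e (total k)) d≡)
  where
  total : ∀ k → 10 + 3 * k ≡ 3 + k + (7 + 2 * k)
  total = solve-∀
... | tri> _ _ 8≤d with m≤n⇒m<n∨m≡n 8≤d
...   | inj₂ d≡ = inj₂ (inj₂ (inj₁ (sym d≡ ,
    trans (cong (_+ (14 + 4 * k)) (profile-at (2 + k) (8 + 2 * k) (trans e (total k)) (sym d≡))) (value k))))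
  where
  total : ∀ k → 10 + 3 * k ≡ 2 + k + (8 + 2 * k)
  total = solve-∀
  value : ∀ k → (2 + k) * ((8 + 2 * k) * (7 + 2 * k)) + (14 + 4 * k) ≡ (3 + k) * ((7 + 2 * k) * (6 + 2 * k))
  value = solve-∀
...   | inj₁ 9≤d = inj₂ (inj₂ (inj₂ (≤-trans
    (+-monoˡ-≤ _ (profile-above (1 + k) (9 + 2 * k) (trans e (total k)) 9≤d (slack 8 (bound k))))
    (slack (39 + 10 * k) (value k)))))
  where
  total : ∀ k → 10 + 3 * k ≡ 1 + k + (9 + 2 * k)
  total = solve-∀
  bound : ∀ k → 2 * (1 + k) + 8 ≡ 1 + (9 + 2 * k)
  bound = solve-∀
  value : ∀ k → (1 + k) * ((9 + 2 * k) * (8 + 2 * k)) + (15 + 4 * k) + (39 + 10 * k) ≡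
          (3 + k) * ((7 + 2 * k) * (6 + 2 * k))
  value = solve-∀
profile-zones₂ k {c} {d} e refl | tri< (s≤s d≤6) _ _ with m≤n⇒m<n∨m≡n d≤6
...   | inj₂ d≡ = inj₂ (inj₁ (d≡ ,
    trans (cong (_+ (6 + 2 * k)) (profile-at (4 + k) (6 + 2 * k) (trans e (total k)) d≡)) (value k)))
  where
  total : ∀ k → 10 + 3 * k ≡ 4 + k + (6 + 2 * k)
  total = solve-∀
  value : ∀ k → (4 + k) * ((6 + 2 * k) * (5 + 2 * k)) + (6 + 2 * k) ≡ (3 + k) * ((7 + 2 * k) * (6 + 2 * k))
  value = solve-∀
...   | inj₁ (s≤s d≤5) = inj₂ (inj₂ (inj₂ (≤-trans
    (+-monoˡ-≤ _ (profile-below (5 + k) (5 + 2 * k) (trans e (total k)) d≤5 (slack 7 (bound k))))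
    (slack (11 + 6 * k) (value k)))))
  where
  total : ∀ k → 10 + 3 * k ≡ 5 + k + (5 + 2 * k)
  total = solve-∀
  bound : ∀ k → 5 + 2 * k + 7 ≡ 2 + 2 * (5 + k)
  bound = solve-∀
  value : ∀ k → (5 + k) * ((5 + 2 * k) * (4 + 2 * k)) + (15 + 4 * k) + (11 + 6 * k) ≡
          (3 + k) * ((7 + 2 * k) * (6 + 2 * k))
  value = solve-∀

-- Summing the losses of vertices

∃⊎∀ : ∀ {n} {P Q : Fin n → Set} → (∀ i → P i ⊎ Q i) → ∃ P ⊎ (∀ i → Q i)
∃⊎∀ {zero}  f = inj₂ λ ()
∃⊎∀ {suc n} f with f zero
... | inj₁ p = inj₁ (zero , p)
... | inj₂ q₀ with ∃⊎∀ (λ i → f (suc i))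
...   | inj₁ (i , p) = inj₁ (suc i , p)
...   | inj₂ q = inj₂ λ { zero → q₀ ; (suc i) → q i }

module _ {n} (q : Fin n → ℕ) (φ : Fin n → Bool) (c w M : ℕ) (count≡ : count φ ≡ c)
         (q≤M : ∀ v → q v ≤ M) (q+w≤M : ∀ v → φ v ≡ true → q v + w ≤ M) where
  private
    pointwise : ∀ v → q v + indicator (φ v) * w ≤ M
    pointwise v with φ v in e
    ... | true  = ≤-trans (≤-reflexive (cong (q v +_) (+-identityʳ w))) (q+w≤M v e)
    ... | false = ≤-trans (≤-reflexive (+-identityʳ (q v))) (q≤M v)

    total : sumFin n (λ v → indicator (φ v) * w) ≡ c * w
    total = trans (sum-*ʳ n w _) (cong (_* w) count≡)

  sum-penalty : sumFin n q + c * w ≤ n * M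
  sum-penalty = ≤-trans (≤-reflexive (cong (sumFin n q +_) (sym total))) (sum-bound n pointwise)

  sum-penalty-tight : sumFin n q + c * w ≡ n * M →
    ∀ v → (φ v ≡ false × q v ≡ M) ⊎ (φ v ≡ true × q v + w ≡ M)
  sum-penalty-tight e v with φ v | sum-bound-tight n pointwise (trans (cong (sumFin n q +_) total) e) v
  ... | true  | t = inj₂ (refl , trans (cong (q v +_) (sym (+-identityʳ w))) t)
  ... | false | t = inj₁ (refl , trans (sym (+-identityʳ (q v))) t)

  -- `τ` stands for the Turán value. If its deficit against `n * M` is exactly the total penalty,
  -- the bound follows, and equality forces every vertex to its own bound.
  module _ {τ : ℕ} (τ+penalty : τ + c * w ≡ n * M) where

    penalised-bound : sumFin n q ≤ τ
    penalised-bound = +-cancelʳ-≤ (c * w) _ _ (≤-trans sum-penalty (≤-reflexive (sym τ+penalty)))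

    penalised-tight : sumFin n q ≡ τ → ∀ v → (φ v ≡ false × q v ≡ M) ⊎ (φ v ≡ true × q v + w ≡ M)
    penalised-tight e = sum-penalty-tight (trans (cong (_+ c * w) e) τ+penalty)

-- The extremal problem for n = 3m, 3m + 1, 3m + 2 with m = k + 3

-- Closes cases with contradictory degree bounds; for numerals `a` and `b` the comparison is decided
-- by evaluation.
clash : ∀ a b {k d} {W : Set} {_ : True (a <? b)} → d ≤ a + k → b + k ≤ d → W
clash a b {k} {_} {_} {a<b} d≤ ≤d =
  contradiction (+-cancelʳ-≤ k b a (≤-trans ≤d d≤)) (<⇒≱ (toWitness a<b))

-- Four times the bound of the theorem, free of binomials and truncated subtraction of parts from
-- `n`.
turanSum : ℕ → ℕ → ℕ → ℕ
turanSum n₁ n₂ n₃ = pairs n₁ * pairs (n₂ + n₃) + pairs n₂ * pairs (n₁ + n₃) + pairs n₃ * pairs (n₁ + n₂)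

turan-balanced : ∀ k → turanSum (3 + k) (3 + k) (3 + k) ≡ (9 + 3 * k) * profile (2 + k) (6 + 2 * k)
turan-balanced k = identity k
  where
  identity : ∀ k → (3 + k) * (2 + k) * ((3 + k + (3 + k)) * (2 + k + (3 + k))) +
                   (3 + k) * (2 + k) * ((3 + k + (3 + k)) * (2 + k + (3 + k))) +
                   (3 + k) * (2 + k) * ((3 + k + (3 + k)) * (2 + k + (3 + k))) ≡
                   (9 + 3 * k) * ((2 + k) * ((6 + 2 * k) * (5 + 2 * k)))
  identity = solve-∀

-- The 2m vertices in the two small parts have degree 2m + 1 and lose 2m each; the large part sits
-- at the peak.
turan-one-large : ∀ k → turanSum (4 + k) (3 + k) (3 + k) + (6 + 2 * k) * (6 + 2 * k) ≡ (10 + 3 * k) * profile (3 + k) (6 + 2 * k)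
turan-one-large k = identity k
  where
  identity : ∀ k → (4 + k) * (3 + k) * ((3 + k + (3 + k)) * (2 + k + (3 + k))) +
                   (3 + k) * (2 + k) * ((4 + k + (3 + k)) * (3 + k + (3 + k))) +
                   (3 + k) * (2 + k) * ((4 + k + (3 + k)) * (3 + k + (3 + k))) +
                   (6 + 2 * k) * (6 + 2 * k) ≡
                   (10 + 3 * k) * ((3 + k) * ((6 + 2 * k) * (5 + 2 * k)))
  identity = solve-∀

-- The m vertices of the small part have degree 2m + 2 and lose 4m + 2 each; the large parts sit at
-- the peak.
turan-two-large : ∀ k → turanSum (4 + k) (4 + k) (3 + k) + (3 + k) * (14 + 4 * k) ≡ (11 + 3 * k) * profile (3 + k) (7 + 2 * k)
turan-two-large k = identity k
  where
  identity : ∀ k → (4 + k) * (3 + k) * ((4 + k + (3 + k)) * (3 + k + (3 + k))) +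
                   (4 + k) * (3 + k) * ((4 + k + (3 + k)) * (3 + k + (3 + k))) +
                   (3 + k) * (2 + k) * ((4 + k + (4 + k)) * (3 + k + (4 + k))) +
                   (3 + k) * (14 + 4 * k) ≡
                   (11 + 3 * k) * ((3 + k) * ((7 + 2 * k) * (6 + 2 * k)))
  identity = solve-∀

positive : ∀ {a s n} → a + s ≡ n → s < n → 0 < a
positive {zero}  e s<n = contradiction e (<⇒≢ s<n)
positive {suc a} e s<n = s≤s z≤n

no-slack : ∀ x w {M} a → x + w ≡ M → x + a ≤ M → w < a → ⊥
no-slack x w a refl le w<a = <⇒≱ w<a (+-cancelˡ-≤ x _ _ le)

weaken : ∀ {x M} a {b} → x + a ≤ M → b ≤ a → x + b ≤ M
weaken {x} a le b≤a = ≤-trans (+-monoʳ-≤ x b≤a) le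

squeeze : ∀ {a x y z} → a ≤ y → a ≤ z → x + (y + z) ≤ a + (a + a) → x ≤ a
squeeze {a} {x} a≤y a≤z le = +-cancelʳ-≤ (a + a) _ _ (≤-trans (+-monoʳ-≤ x (+-mono-≤ a≤y a≤z)) le)

-- `L` is the loss of the Turán graph and `X` a lower bound for the loss of the given colouring.
deficit-strict : ∀ {S} τ L {X K} → τ + L ≡ K → S + X ≤ K → L < X → S < τ
deficit-strict {S} τ L {X} refl le L<X = +-cancelʳ-< X S τ (≤-<-trans le (+-monoʳ-< τ L<X))

module Extremal {n : ℕ} (G : Colouring n) where
  open Graph G

  -- The bound and its equality case are kept together, so that a strict inequality settles both.
  Extremal : ℕ → ℕ → ℕ → ℕ → Set
  Extremal τ n₁ n₂ n₃ = sumFin n q ≤ τ × (sumFin n q ≡ τ → Triangle n₁ n₂ n₃)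

  strictly-below : ∀ {τ n₁ n₂ n₃} → sumFin n q < τ → Extremal τ n₁ n₂ n₃
  strictly-below lt = <⇒≤ lt , λ e → contradiction e (<⇒≢ lt)

  size-from-deg : ∀ {v} d s → n ≡ d + s → deg v ≡ d → size v ≡ s
  size-from-deg {v} d s e refl = +-cancelˡ-≡ d _ _ (trans (deg+size v) e)

  second : ∀ v → size v < n → ∃ λ w → r v w ≡ true
  second v s<n = count-witness (r v) (positive (deg+size v) s<n)

  third : ∀ {v w} → Closed v → r v w ≡ true → size v + size w < n → ∃ λ x → r v x ≡ true × r w x ≡ true
  third {v} {w} cl rvw s<n =
    let x , ox = count-witness (outside v w) (positive (count-outside cl rvw) s<n)
    in x , ∧-true (r v x) ox

  bdeg+deg : ∀ {N} → n ≡ suc N → ∀ v → bdeg v + deg v ≡ N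
  bdeg+deg e v = trans (+-comm (bdeg v) (deg v)) (suc-injective (trans (deg+bdeg v) e))

  q-closed⊎gap : ∀ {d} v → deg v ≡ suc d → Closed v ⊎ q v + 2 * d ≤ profile (bdeg v) (deg v)
  q-closed⊎gap v e with closed⊎gap v
  ... | inj₁ cl  = inj₁ cl
  ... | inj₂ gap = inj₂ (subst (λ x → q v + 2 * (x ∸ 1) ≤ profile (bdeg v) (deg v)) e gap)

  all-penalised : ∀ {w M} → (∀ v → q v + w ≤ M) → sumFin n q + n * w ≤ n * M
  all-penalised {w} le = ≤-trans (≤-reflexive (cong (sumFin n q +_) (sym (sum-const n w)))) (sum-bound n le)

  -- Here d = 2m and d = 2m − 1 tie, so classes of size m + 1 are excluded only by fitting three classes into n.
  module Balanced (k : ℕ) (n≡ : n ≡ 9 + 3 * k) {M τ : ℕ}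
    (M≡ : profile (2 + k) (6 + 2 * k) ≡ M) (turan≡ : τ ≡ n * M) where
    to-n : ∀ {x} → x ≡ 9 + 3 * k → x ≡ n
    to-n e = trans e (sym n≡)

    tight : Fin n → Set
    tight v = Closed v × 3 + k ≤ size v × size v ≤ 4 + k × q v ≤ M

    types : ∀ v → tight v ⊎ q v < M
    types v with profile-zones₀ k {bdeg v} {deg v} (bdeg+deg n≡ v) M≡
    ... | inj₂ (inj₂ h<) = inj₂ (≤-<-trans (q≤ v) h<)
    ... | inj₁ (d≡ , h≡) with q-closed⊎gap v d≡
    ...   | inj₁ cl = inj₁ (cl , ≤-reflexive (sym s≡) , ≤-trans (≤-reflexive s≡) (n≤1+n _) , ≤-trans (q≤ v) (≤-reflexive h≡))
      where
      s≡ : size v ≡ 3 + k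
      s≡ = size-from-deg (6 + 2 * k) (3 + k) (trans n≡ (solve (k ∷ []))) d≡
    ...   | inj₂ gap = inj₂ (≤-trans (≤-reflexive (+-comm 1 (q v))) (weaken (2 * (5 + 2 * k)) (≤-trans gap (≤-reflexive h≡)) (s≤s z≤n)))
    types v | inj₂ (inj₁ (d≡ , h≡)) with q-closed⊎gap v d≡
    ...   | inj₁ cl = inj₁ (cl , ≤-trans (n≤1+n _) (≤-reflexive (sym s≡)) , ≤-reflexive s≡ , ≤-trans (q≤ v) (≤-reflexive h≡))
      where
      s≡ : size v ≡ 4 + k
      s≡ = size-from-deg (5 + 2 * k) (4 + k) (trans n≡ (solve (k ∷ []))) d≡
    ...   | inj₂ gap = inj₂ (≤-trans (≤-reflexive (+-comm 1 (q v))) (weaken (2 * (4 + 2 * k)) (≤-trans gap (≤-reflexive h≡)) (s≤s z≤n)))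

    q≤M : ∀ v → q v ≤ M
    q≤M v with types v
    ... | inj₁ (_ , _ , _ , le) = le
    ... | inj₂ lt = <⇒≤ lt

    extremal : Extremal τ (3 + k) (3 + k) (3 + k)
    extremal = ≤-trans (sum-mono n q≤M) (≤-reflexive (trans (sum-const n M) (sym turan≡))) , equality
      where
      equality : sumFin n q ≡ τ → Triangle (3 + k) (3 + k) (3 + k)
      equality e = record
        { closed = closed ; v₁ = v₁ ; v₂ = v₂ ; v₃ = v₃ ; r₁₂ = r₁₂ ; r₁₃ = r₁₃ ; r₂₃ = r₂₃
        ; size₁ = exact v₁ (rotate (size v₃) (size v₁) (size v₂)) (low v₂) (low v₃)
        ; size₂ = exact v₂ (rotate′ (size v₃) (size v₁) (size v₂)) (low v₃) (low v₁)
        ; size₃ = exact v₃ refl (low v₁) (low v₂) }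
        where
        all-tight : ∀ v → tight v
        all-tight v with types v
        ... | inj₁ t  = t
        ... | inj₂ lt = contradiction
              (sum-mono-tight n q≤M (trans e (trans turan≡ (sym (sum-const n M)))) v) (<⇒≢ lt)
        closed : ∀ v → Closed v
        closed v = proj₁ (all-tight v)
        low : ∀ v → 3 + k ≤ size v
        low v = proj₁ (proj₂ (all-tight v))
        high : ∀ v → size v ≤ 4 + k
        high v = proj₁ (proj₂ (proj₂ (all-tight v)))
        fits₁ : 4 + k < n
        fits₁ = slack (4 + 2 * k) (to-n (solve (k ∷ [])))
        -- A third class exists because 2(m + 1) < 3m, which holds for m ≥ 3.
        fits₂ : 4 + k + (4 + k) < n
        fits₂ = slack k (to-n (solve (k ∷ [])))
        v₁ : Fin n
        v₁ = subst Fin (sym n≡) zero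
        v₂,r₁₂ : ∃ λ w → r v₁ w ≡ true
        v₂,r₁₂ = second v₁ (≤-<-trans (high v₁) fits₁)
        v₂ : Fin n
        v₂ = proj₁ v₂,r₁₂
        r₁₂ : r v₁ v₂ ≡ true
        r₁₂ = proj₂ v₂,r₁₂
        v₃,r₁₃,r₂₃ : ∃ λ w → r v₁ w ≡ true × r v₂ w ≡ true
        v₃,r₁₃,r₂₃ = third (closed v₁) r₁₂ (≤-<-trans (+-mono-≤ (high v₁) (high v₂)) fits₂)
        v₃ : Fin n
        v₃ = proj₁ v₃,r₁₃,r₂₃
        r₁₃ : r v₁ v₃ ≡ true
        r₁₃ = proj₁ (proj₂ v₃,r₁₃,r₂₃)
        r₂₃ : r v₂ v₃ ≡ true
        r₂₃ = proj₂ (proj₂ v₃,r₁₃,r₂₃)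
        rotate : ∀ a b c → b + (c + a) ≡ a + (b + c)
        rotate = solve-∀
        rotate′ : ∀ a b c → c + (a + b) ≡ a + (b + c)
        rotate′ = solve-∀
        total : size v₃ + (size v₁ + size v₂) ≤ 3 + k + (3 + k + (3 + k))
        total = ≤-trans (three-classes (closed v₁) (closed v₂) r₁₂ r₁₃ r₂₃) (≤-reflexive (trans n≡ (solve (k ∷ []))))
        -- The three sizes total at most 3m and each is at least m, so each equals m.
        exact : ∀ v {y z} → size v + (y + z) ≡ size v₃ + (size v₁ + size v₂) →
                3 + k ≤ y → 3 + k ≤ z → size v ≡ 3 + k
        exact v s≡ ly lz = ≤-antisym (squeeze ly lz (≤-trans (≤-reflexive s≡) total)) (low v)

  module OneLarge (k : ℕ) (n≡ : n ≡ 10 + 3 * k) {M τ : ℕ}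
    (M≡ : profile (3 + k) (6 + 2 * k) ≡ M) (turan≡ : τ + (6 + 2 * k) * (6 + 2 * k) ≡ n * M) where
    to-n : ∀ {x} → x ≡ 10 + 3 * k → x ≡ n
    to-n e = trans e (sym n≡)

    -- `Good` describes the small parts of the Turán graph, with loss 2m. `Bad` vertices lose at
    -- least 2m + 1, and 10m + 4 if their degree is at least 2m + 2.
    Clean Good Bad : Fin n → Set
    Clean v = Closed v × deg v ≡ 6 + 2 * k × q v ≤ M
    Good v  = Closed v × deg v ≡ 7 + 2 * k × q v + (6 + 2 * k) ≤ M
    Bad v   = q v + (7 + 2 * k) ≤ M × (8 + 2 * k ≤ deg v → q v + (34 + 10 * k) ≤ M)

    types : ∀ v → Clean v ⊎ Good v ⊎ Bad v
    types v with profile-zones₁ k {bdeg v} {deg v} (bdeg+deg n≡ v) M≡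
    ... | inj₂ (inj₂ (inj₂ h≤)) =
      let le = ≤-trans (+-monoˡ-≤ _ (q≤ v)) h≤
      in inj₂ (inj₂ (weaken (34 + 10 * k) le (slack (27 + 8 * k) (solve (k ∷ []))) , λ _ → le))
    ... | inj₂ (inj₂ (inj₁ (d≤ , h≤))) = inj₂ (inj₂
      ( weaken (10 + 4 * k) (≤-trans (+-monoˡ-≤ _ (q≤ v)) h≤) (slack (3 + 2 * k) (solve (k ∷ [])))
      , λ 8≤d → clash 5 8 d≤ 8≤d))
    types v | inj₁ (d≡ , h≡) with q-closed⊎gap v d≡
    ...   | inj₁ cl  = inj₁ (cl , d≡ , ≤-trans (q≤ v) (≤-reflexive h≡))
    ...   | inj₂ gap = inj₂ (inj₂
      ( weaken (2 * (5 + 2 * k)) (≤-trans gap (≤-reflexive h≡)) (slack (3 + 2 * k) (solve (k ∷ [])))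
      , λ 8≤d → clash 6 8 (≤-reflexive d≡) 8≤d))
    types v | inj₂ (inj₁ (d≡ , h≡)) with q-closed⊎gap v d≡
    ...   | inj₁ cl  = inj₂ (inj₁ (cl , d≡ , ≤-trans (+-monoˡ-≤ _ (q≤ v)) (≤-reflexive h≡)))
    -- Failing to be closed costs 4m here, which is enough by itself; the loss from the degree is
    -- dropped.
    ...   | inj₂ gap = inj₂ (inj₂
      ( weaken (2 * (6 + 2 * k)) (≤-trans gap (m+n≤o⇒m≤o _ (≤-reflexive h≡))) (slack (5 + 2 * k) (solve (k ∷ [])))
      , λ 8≤d → clash 7 8 (≤-reflexive d≡) 8≤d))

    unclean : ∀ {v} → Good v ⊎ Bad v → q v + (6 + 2 * k) ≤ M
    unclean (inj₁ (_ , _ , le)) = le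
    unclean (inj₂ (le , _))     = weaken (7 + 2 * k) le (n≤1+n _)

    q≤M : ∀ v → q v ≤ M
    q≤M v with types v
    ... | inj₁ (_ , _ , le) = le
    ... | inj₂ u            = m+n≤o⇒m≤o _ (unclean u)

    size-clean : ∀ {v} → Clean v → size v ≡ 4 + k
    size-clean (_ , d≡ , _) = size-from-deg (6 + 2 * k) (4 + k) (trans n≡ (solve (k ∷ []))) d≡

    -- The m - 1 vertices outside two clean classes have degree at least 2m + 2, and (m - 1)(10m +
    -- 4) exceeds the Turán loss 4m².
    two-clean : ∀ {v w} → Clean v → Clean w → r v w ≡ true → Extremal τ (4 + k) (3 + k) (3 + k)
    two-clean {v} {w} cv cw rvw = strictly-below (deficit-strict τ ((6 + 2 * k) * (6 + 2 * k)) turan≡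
      (sum-penalty q (outside v w) (2 + k) (34 + 10 * k) M rest q≤M penalty)
      (slack (31 + 30 * k + 6 * (k * k)) (identity k)))
      where
      sizes : size v + size w ≡ 8 + 2 * k
      sizes = trans (cong₂ _+_ (size-clean cv) (size-clean cw)) (solve (k ∷ []))
      rest : count (outside v w) ≡ 2 + k
      rest = +-cancelʳ-≡ (8 + 2 * k) _ _ (trans (cong (count (outside v w) +_) (sym sizes))
               (trans (count-outside (proj₁ cv) rvw) (trans n≡ (solve (k ∷ [])))))
      penalty : ∀ x → outside v w x ≡ true → q x + (34 + 10 * k) ≤ M
      penalty x ox with ≤-trans (≤-reflexive (sym sizes)) (deg-outside (proj₁ cv) (proj₁ cw) rvw ox) | types x
      ... | 8≤d | inj₁ (_ , d≡ , _)        = clash 6 8 (≤-reflexive d≡) 8≤d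
      ... | 8≤d | inj₂ (inj₁ (_ , d≡ , _)) = clash 7 8 (≤-reflexive d≡) 8≤d
      ... | 8≤d | inj₂ (inj₂ (_ , le))     = le 8≤d
      identity : ∀ k → suc ((6 + 2 * k) * (6 + 2 * k)) + (31 + 30 * k + 6 * (k * k)) ≡ (2 + k) * (34 + 10 * k)
      identity = solve-∀

    -- The 2m red neighbours of the clean vertex lose at least 2m each, just the Turán loss.
    -- Equality makes them all `Good` and the rest `Clean`, so the further classes have size m.
    one-clean : ∀ {v} → Clean v → (∀ w → r v w ≡ true → Good w ⊎ Bad w) → Extremal τ (4 + k) (3 + k) (3 + k)
    one-clean {v₁} c₁@(_ , d₁ , _) rest =
      penalised-bound q (r v₁) (6 + 2 * k) (6 + 2 * k) M d₁ q≤M penalty turan≡ ,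
      λ e → equality (penalised-tight q (r v₁) (6 + 2 * k) (6 + 2 * k) M d₁ q≤M penalty turan≡ e)
      where
      penalty : ∀ x → r v₁ x ≡ true → q x + (6 + 2 * k) ≤ M
      penalty x rx = unclean (rest x rx)
      equality : (∀ x → (r v₁ x ≡ false × q x ≡ M) ⊎ (r v₁ x ≡ true × q x + (6 + 2 * k) ≡ M)) → Triangle (4 + k) (3 + k) (3 + k)
      equality vertex = record
        { closed = closed ; v₁ = v₁ ; v₂ = v₂ ; v₃ = proj₁ v₃,r ; r₁₂ = r₁₂
        ; r₁₃ = proj₁ (proj₂ v₃,r) ; r₂₃ = proj₂ (proj₂ v₃,r)
        ; size₁ = size-clean c₁ ; size₂ = size-out r₁₂ ; size₃ = size-out (proj₁ (proj₂ v₃,r)) }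
        where
        good-out : ∀ {x} → r v₁ x ≡ true → q x + (6 + 2 * k) ≡ M → Good x
        good-out {x} rx qx with rest x rx
        ... | inj₁ g        = g
        ... | inj₂ (le , _) = ⊥-elim (no-slack (q x) (6 + 2 * k) (7 + 2 * k) qx le (n<1+n _))
        closed : ∀ x → Closed x
        closed x with vertex x | types x
        ... | inj₂ (rx , qx) | _      = proj₁ (good-out rx qx)
        ... | inj₁ (_ , qx)  | inj₁ c = proj₁ c
        ... | inj₁ (_ , qx)  | inj₂ u = ⊥-elim (no-slack (q x) 0 (6 + 2 * k) (trans (+-identityʳ (q x)) qx) (unclean u) (s≤s z≤n))
        size-out : ∀ {x} → r v₁ x ≡ true → size x ≡ 3 + k
        size-out {x} rx with vertex x
        ... | inj₁ (rx′ , _) = ⊥-elim (true≢false rx rx′)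
        ... | inj₂ (_ , qx)  = size-from-deg (7 + 2 * k) (3 + k) (trans n≡ (solve (k ∷ []))) (proj₁ (proj₂ (good-out rx qx)))
        v₂,r₁₂ : ∃ λ x → r v₁ x ≡ true
        v₂,r₁₂ = second v₁ (slack (5 + 2 * k) (trans (cong (λ s → suc s + (5 + 2 * k)) (size-clean c₁)) (to-n (solve (k ∷ [])))))
        v₂ : Fin n
        v₂ = proj₁ v₂,r₁₂
        r₁₂ : r v₁ v₂ ≡ true
        r₁₂ = proj₂ v₂,r₁₂
        v₃,r : ∃ λ x → r v₁ x ≡ true × r v₂ x ≡ true
        v₃,r = third (closed v₁) r₁₂ (slack (2 + k)
          (trans (cong₂ (λ s t → suc (s + t) + (2 + k)) (size-clean c₁) (size-out r₁₂)) (to-n (solve (k ∷ [])))))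

    extremal : Extremal τ (4 + k) (3 + k) (3 + k)
    extremal with ∃⊎∀ types
    -- Without clean vertices all 3m + 1 vertices lose at least 2m, more than 4m² in total.
    ... | inj₂ none = strictly-below (deficit-strict τ ((6 + 2 * k) * (6 + 2 * k)) turan≡ (all-penalised {6 + 2 * k} (λ v → unclean (none v)))
                        (subst (λ x → (6 + 2 * k) * (6 + 2 * k) < x * (6 + 2 * k)) (sym n≡) (slack (23 + 14 * k + 2 * (k * k)) (identity k))))
      where
      identity : ∀ k → suc ((6 + 2 * k) * (6 + 2 * k)) + (23 + 14 * k + 2 * (k * k)) ≡ (10 + 3 * k) * (6 + 2 * k)
      identity = solve-∀
    -- A clean red neighbour of `v` represents a second clean class.
    ... | inj₁ (v , cv) with ∃⊎∀ other
      where
      other : ∀ w → (Clean w × r v w ≡ true) ⊎ (r v w ≡ true → Good w ⊎ Bad w)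
      other w with types w | r v w
      ... | inj₁ cw | true  = inj₁ (cw , refl)
      ... | inj₁ cw | false = inj₂ λ ()
      ... | inj₂ u  | _     = inj₂ λ _ → u
    ...   | inj₁ (w , cw , rvw) = two-clean cv cw rvw
    ...   | inj₂ rest           = one-clean cv rest

  module TwoLarge (k : ℕ) (n≡ : n ≡ 11 + 3 * k) {M τ : ℕ}
    (M≡ : profile (3 + k) (7 + 2 * k) ≡ M) (turan≡ : τ + (3 + k) * (14 + 4 * k) ≡ n * M) where
    to-n : ∀ {x} → x ≡ 11 + 3 * k → x ≡ n
    to-n e = trans e (sym n≡)

    -- `Good` describes the small part of the Turán graph. From degree 2m + 2 on, a `Bad` vertex
    -- loses one more than a `Good` one, so that equality can tell them apart.
    Clean Low Good Bad : Fin n → Set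
    Clean v = Closed v × deg v ≡ 7 + 2 * k × q v ≤ M
    Low v   = Closed v × deg v ≡ 6 + 2 * k × q v + (6 + 2 * k) ≤ M
    Good v  = Closed v × deg v ≡ 8 + 2 * k × q v + (14 + 4 * k) ≤ M
    Bad v   = q v + (7 + 2 * k) ≤ M × (8 + 2 * k ≤ deg v → q v + (15 + 4 * k) ≤ M)

    types : ∀ v → Clean v ⊎ Low v ⊎ Good v ⊎ Bad v
    types v with profile-zones₂ k {bdeg v} {deg v} (bdeg+deg n≡ v) M≡
    ... | inj₂ (inj₂ (inj₂ h≤)) =
      let le = ≤-trans (+-monoˡ-≤ _ (q≤ v)) h≤
      in inj₂ (inj₂ (inj₂ (weaken (15 + 4 * k) le (slack (8 + 2 * k) (solve (k ∷ []))) , λ _ → le)))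
    types v | inj₁ (d≡ , h≡) with q-closed⊎gap v d≡
    ...   | inj₁ cl  = inj₁ (cl , d≡ , ≤-trans (q≤ v) (≤-reflexive h≡))
    ...   | inj₂ gap = inj₂ (inj₂ (inj₂
      ( weaken (2 * (6 + 2 * k)) (≤-trans gap (≤-reflexive h≡)) (slack (5 + 2 * k) (solve (k ∷ [])))
      , clash 7 8 (≤-reflexive d≡))))
    types v | inj₂ (inj₁ (d≡ , h≡)) with q-closed⊎gap v d≡
    ...   | inj₁ cl  = inj₂ (inj₁ (cl , d≡ , ≤-trans (+-monoˡ-≤ _ (q≤ v)) (≤-reflexive h≡)))
    ...   | inj₂ gap = inj₂ (inj₂ (inj₂
      ( weaken (2 * (5 + 2 * k)) (≤-trans gap (m+n≤o⇒m≤o _ (≤-reflexive h≡))) (slack (3 + 2 * k) (solve (k ∷ [])))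
      , clash 6 8 (≤-reflexive d≡))))
    types v | inj₂ (inj₂ (inj₁ (d≡ , h≡))) with q-closed⊎gap v d≡
    ...   | inj₁ cl  = inj₂ (inj₂ (inj₁ (cl , d≡ , ≤-trans (+-monoˡ-≤ _ (q≤ v)) (≤-reflexive h≡))))
    ...   | inj₂ gap = inj₂ (inj₂ (inj₂ (weaken (15 + 4 * k) le (slack (8 + 2 * k) (solve (k ∷ []))) , λ _ → le)))
      where
      -- The failure to be closed costs 4m + 2, one short of what `Bad` asks, so the loss from the
      -- degree is added.
      both : q v + (2 * (7 + 2 * k) + (14 + 4 * k)) ≤ M
      both = ≤-trans (≤-reflexive (sym (+-assoc (q v) _ _)))
               (≤-trans (+-monoˡ-≤ (14 + 4 * k) gap) (≤-reflexive h≡))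
      le : q v + (15 + 4 * k) ≤ M
      le = weaken (2 * (7 + 2 * k) + (14 + 4 * k)) both (slack (13 + 4 * k) (solve (k ∷ [])))

    unclean : ∀ {v} → Low v ⊎ Good v ⊎ Bad v → q v + (6 + 2 * k) ≤ M
    unclean (inj₁ (_ , _ , le))        = le
    unclean (inj₂ (inj₁ (_ , _ , le))) = weaken (14 + 4 * k) le (slack (8 + 2 * k) (solve (k ∷ [])))
    unclean (inj₂ (inj₂ (le , _)))     = weaken (7 + 2 * k) le (n≤1+n _)

    q≤M : ∀ v → q v ≤ M
    q≤M v with types v
    ... | inj₁ (_ , _ , le) = le
    ... | inj₂ u            = m+n≤o⇒m≤o _ (unclean u)

    size-clean : ∀ {v} → Clean v → size v ≡ 4 + k
    size-clean (_ , d≡ , _) = size-from-deg (7 + 2 * k) (4 + k) (trans n≡ (solve (k ∷ []))) d≡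

    -- The m vertices outside both classes have degree at least 2m + 2 and lose at least 4m + 2
    -- each, just the Turán loss. Equality makes them `Good`, so their class has size m.
    two-clean : ∀ {v w} → Clean v → Clean w → r v w ≡ true → Extremal τ (4 + k) (4 + k) (3 + k)
    two-clean {v₁} {v₂} c₁ c₂ r₁₂ =
      penalised-bound q (outside v₁ v₂) (3 + k) (14 + 4 * k) M rest q≤M penalty turan≡ ,
      λ e → equality (penalised-tight q (outside v₁ v₂) (3 + k) (14 + 4 * k) M rest q≤M penalty turan≡ e)
      where
      sizes : size v₁ + size v₂ ≡ 8 + 2 * k
      sizes = trans (cong₂ _+_ (size-clean c₁) (size-clean c₂)) (solve (k ∷ []))
      rest : count (outside v₁ v₂) ≡ 3 + k
      rest = +-cancelʳ-≡ (8 + 2 * k) _ _ (trans (cong (count (outside v₁ v₂) +_) (sym sizes))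
               (trans (count-outside (proj₁ c₁) r₁₂) (trans n≡ (solve (k ∷ [])))))
      deg≥ : ∀ {x} → outside v₁ v₂ x ≡ true → 8 + 2 * k ≤ deg x
      deg≥ ox = ≤-trans (≤-reflexive (sym sizes)) (deg-outside (proj₁ c₁) (proj₁ c₂) r₁₂ ox)
      good-or-worse : ∀ {x} → outside v₁ v₂ x ≡ true → Good x ⊎ q x + (15 + 4 * k) ≤ M
      good-or-worse {x} ox with types x
      ... | inj₁ (_ , d≡ , _)        = clash 7 8 (≤-reflexive d≡) (deg≥ ox)
      ... | inj₂ (inj₁ (_ , d≡ , _)) = clash 6 8 (≤-reflexive d≡) (deg≥ ox)
      ... | inj₂ (inj₂ (inj₁ g))     = inj₁ g
      ... | inj₂ (inj₂ (inj₂ (_ , le))) = inj₂ (le (deg≥ ox))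
      penalty : ∀ x → outside v₁ v₂ x ≡ true → q x + (14 + 4 * k) ≤ M
      penalty x ox with good-or-worse ox
      ... | inj₁ (_ , _ , le) = le
      ... | inj₂ le           = weaken (15 + 4 * k) le (n≤1+n _)
      equality : (∀ x → (outside v₁ v₂ x ≡ false × q x ≡ M) ⊎ (outside v₁ v₂ x ≡ true × q x + (14 + 4 * k) ≡ M)) → Triangle (4 + k) (4 + k) (3 + k)
      equality vertex = record
        { closed = closed ; v₁ = v₁ ; v₂ = v₂ ; v₃ = v₃ ; r₁₂ = r₁₂
        ; r₁₃ = proj₁ (∧-true (r v₁ v₃) o₃) ; r₂₃ = proj₂ (∧-true (r v₁ v₃) o₃)
        ; size₁ = size-clean c₁ ; size₂ = size-clean c₂ ; size₃ = size-out o₃ }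
        where
        good-out : ∀ {x} → outside v₁ v₂ x ≡ true → q x + (14 + 4 * k) ≡ M → Good x
        good-out {x} ox qx with good-or-worse ox
        ... | inj₁ g  = g
        ... | inj₂ le = ⊥-elim (no-slack (q x) (14 + 4 * k) (15 + 4 * k) qx le (n<1+n _))
        closed : ∀ x → Closed x
        closed x with vertex x | types x
        ... | inj₂ (ox , qx) | _      = proj₁ (good-out ox qx)
        ... | inj₁ (_ , qx)  | inj₁ c = proj₁ c
        ... | inj₁ (_ , qx)  | inj₂ u = ⊥-elim (no-slack (q x) 0 (6 + 2 * k) (trans (+-identityʳ (q x)) qx) (unclean u) (s≤s z≤n))
        size-out : ∀ {x} → outside v₁ v₂ x ≡ true → size x ≡ 3 + k
        size-out {x} ox with vertex x
        ... | inj₁ (ox′ , _) = ⊥-elim (true≢false ox ox′)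
        ... | inj₂ (_ , qx)  = size-from-deg (8 + 2 * k) (3 + k) (trans n≡ (solve (k ∷ []))) (proj₁ (proj₂ (good-out ox qx)))
        v₃,o : ∃ λ x → outside v₁ v₂ x ≡ true
        v₃,o = count-witness (outside v₁ v₂) (≤-trans (s≤s z≤n) (≤-reflexive (sym rest)))
        v₃ : Fin n
        v₃ = proj₁ v₃,o
        o₃ : outside v₁ v₂ v₃ ≡ true
        o₃ = proj₂ v₃,o

    -- With a single clean class the loss equals that of the Turán graph only if every other vertex is
    -- Low, and two further classes of size m + 2 do not fit.
    one-clean : ∀ {v} → Clean v → (∀ w → r v w ≡ true → Low w ⊎ Good w ⊎ Bad w) → Extremal τ (4 + k) (4 + k) (3 + k)
    one-clean {v₁} c₁@(_ , d₁ , _) rest =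
      penalised-bound q (r v₁) (7 + 2 * k) (6 + 2 * k) M d₁ q≤M penalty turan≡′ ,
      λ e → ⊥-elim (equality (penalised-tight q (r v₁) (7 + 2 * k) (6 + 2 * k) M d₁ q≤M penalty turan≡′ e))
      where
      penalty : ∀ x → r v₁ x ≡ true → q x + (6 + 2 * k) ≤ M
      penalty x rx = unclean (rest x rx)
      -- The 2m + 1 red neighbours at 2m each lose as much as the m vertices of the small Turán part
      -- at 4m + 2 each.
      turan≡′ : τ + (7 + 2 * k) * (6 + 2 * k) ≡ n * M
      turan≡′ = trans (cong (τ +_) (identity k)) turan≡
        where
        identity : ∀ k → (7 + 2 * k) * (6 + 2 * k) ≡ (3 + k) * (14 + 4 * k)
        identity = solve-∀
      equality : (∀ x → (r v₁ x ≡ false × q x ≡ M) ⊎ (r v₁ x ≡ true × q x + (6 + 2 * k) ≡ M)) → ⊥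
      equality vertex = <⇒≱ (≤-trans too-big (≤-reflexive (sym total))) (three-classes (proj₁ c₁) (proj₁ (low r₁₂)) r₁₂ r₁₃ r₂₃)
        where
        low : ∀ {x} → r v₁ x ≡ true → Low x
        low {x} rx with vertex x | rest x rx
        ... | inj₁ (rx′ , _) | _      = ⊥-elim (true≢false rx rx′)
        ... | inj₂ (_ , qx)  | inj₁ l = l
        ... | inj₂ (_ , qx)  | inj₂ (inj₁ (_ , _ , le)) = ⊥-elim (no-slack (q x) (6 + 2 * k) (14 + 4 * k) qx le (slack (7 + 2 * k) (solve (k ∷ []))))
        ... | inj₂ (_ , qx)  | inj₂ (inj₂ (le , _))     = ⊥-elim (no-slack (q x) (6 + 2 * k) (7 + 2 * k) qx le (n<1+n _))
        size-low : ∀ {x} → r v₁ x ≡ true → size x ≡ 5 + k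
        size-low rx = size-from-deg (6 + 2 * k) (5 + k) (trans n≡ (solve (k ∷ []))) (proj₁ (proj₂ (low rx)))
        v₂,r₁₂ : ∃ λ x → r v₁ x ≡ true
        v₂,r₁₂ = second v₁ (slack (6 + 2 * k) (trans (cong (λ s → suc s + (6 + 2 * k)) (size-clean c₁)) (to-n (solve (k ∷ [])))))
        v₂ : Fin n
        v₂ = proj₁ v₂,r₁₂
        r₁₂ : r v₁ v₂ ≡ true
        r₁₂ = proj₂ v₂,r₁₂
        v₃,r : ∃ λ x → r v₁ x ≡ true × r v₂ x ≡ true
        v₃,r = third (proj₁ c₁) r₁₂ (slack (1 + k)
          (trans (cong₂ (λ s t → suc (s + t) + (1 + k)) (size-clean c₁) (size-low r₁₂)) (to-n (solve (k ∷ [])))))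
        v₃ : Fin n
        v₃ = proj₁ v₃,r
        r₁₃ : r v₁ v₃ ≡ true
        r₁₃ = proj₁ (proj₂ v₃,r)
        r₂₃ : r v₂ v₃ ≡ true
        r₂₃ = proj₂ (proj₂ v₃,r)
        total : size v₃ + (size v₁ + size v₂) ≡ 5 + k + (4 + k + (5 + k))
        total = cong₂ _+_ (size-low r₁₃) (cong₂ _+_ (size-clean c₁) (size-low r₁₂))
        too-big : suc n ≤ 5 + k + (4 + k + (5 + k))
        too-big = ≤-trans (s≤s (≤-reflexive n≡)) (slack 2 (identity k))
          where
          identity : ∀ k → suc (11 + 3 * k) + 2 ≡ 5 + k + (4 + k + (5 + k))
          identity = solve-∀

    extremal : Extremal τ (4 + k) (4 + k) (3 + k)
    extremal with ∃⊎∀ types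
    -- Without clean vertices the loss is at least (3m + 2) · 2m, which exceeds m(4m + 2).
    ... | inj₂ none = strictly-below (deficit-strict τ ((3 + k) * (14 + 4 * k)) turan≡ (all-penalised {6 + 2 * k} (λ v → unclean (none v)))
                        (subst (λ x → (3 + k) * (14 + 4 * k) < x * (6 + 2 * k)) (sym n≡) (slack (23 + 14 * k + 2 * (k * k)) (identity k))))
      where
      identity : ∀ k → suc ((3 + k) * (14 + 4 * k)) + (23 + 14 * k + 2 * (k * k)) ≡ (11 + 3 * k) * (6 + 2 * k)
      identity = solve-∀
    ... | inj₁ (v , cv) with ∃⊎∀ other
      where
      other : ∀ w → (Clean w × r v w ≡ true) ⊎ (r v w ≡ true → Low w ⊎ Good w ⊎ Bad w)
      other w with types w | r v w
      ... | inj₁ cw | true  = inj₁ (cw , refl)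
      ... | inj₁ cw | false = inj₂ λ ()
      ... | inj₂ u  | _     = inj₂ λ _ → u
    ...   | inj₁ (w , cw , rvw) = two-clean cv cw rvw
    ...   | inj₂ rest           = one-clean cv rest

  -- With m = `n₃`, the size conditions leave three shapes: all parts equal, two parts m + 1, or
  -- only the first part m + 1.
  extremal : ∀ {n₁ n₂ n₃} → 3 ≤ n₃ → n₁ + n₂ + n₃ ≡ n → n₂ ≤ n₁ → n₃ ≤ n₂ → n₁ ≤ suc n₃ →
             Extremal (turanSum n₁ n₂ n₃) n₁ n₂ n₃
  extremal {n₁} {n₂} {suc (suc (suc k))} (s≤s (s≤s (s≤s _))) sum-n n₂≤n₁ n₃≤n₂ n₁≤
    with m≤n⇒m<n∨m≡n n₁≤ | m≤n⇒m<n∨m≡n n₃≤n₂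
  ... | inj₁ (s≤s n₁≤n₃) | _
    rewrite ≤-antisym n₁≤n₃ (≤-trans n₃≤n₂ n₂≤n₁) | ≤-antisym (≤-trans n₂≤n₁ n₁≤n₃) n₃≤n₂ =
    let n≡ : n ≡ 9 + 3 * k
        n≡ = trans (sym sum-n) (solve (k ∷ []))
    in Balanced.extremal k n≡ refl (subst (λ x → turanSum (3 + k) (3 + k) (3 + k) ≡ x * profile (2 + k) (6 + 2 * k)) (sym n≡) (turan-balanced k))
  ... | inj₂ refl | inj₁ n₃<n₂ rewrite ≤-antisym n₂≤n₁ n₃<n₂ =
    let n≡ : n ≡ 11 + 3 * k
        n≡ = trans (sym sum-n) (solve (k ∷ []))
    in TwoLarge.extremal k n≡ refl (subst (λ x → turanSum (4 + k) (4 + k) (3 + k) + (3 + k) * (14 + 4 * k) ≡ x * profile (3 + k) (7 + 2 * k)) (sym n≡) (turan-two-large k))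
  ... | inj₂ refl | inj₂ refl =
    let n≡ : n ≡ 10 + 3 * k
        n≡ = trans (sym sum-n) (solve (k ∷ []))
    in OneLarge.extremal k n≡ refl (subst (λ x → turanSum (4 + k) (3 + k) (3 + k) + (6 + 2 * k) * (6 + 2 * k) ≡ x * profile (3 + k) (6 + 2 * k)) (sym n≡) (turan-one-large k))

-- Return to binomial coefficients

4*turanBound : ∀ n n₁ n₂ n₃ → 4 * turanBound n n₁ n₂ n₃ ≡
  pairs n₁ * pairs (n ∸ n₁) + pairs n₂ * pairs (n ∸ n₂) + pairs n₃ * pairs (n ∸ n₃)
4*turanBound n n₁ n₂ n₃ = trans
  (spread (n₁ C 2) ((n ∸ n₁) C 2) (n₂ C 2) ((n ∸ n₂) C 2) (n₃ C 2) ((n ∸ n₃) C 2))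
  (cong₂ _+_ (cong₂ _+_ (product n₁) (product n₂)) (product n₃))
  where
  product : ∀ m → 2 * (m C 2) * (2 * ((n ∸ m) C 2)) ≡ pairs m * pairs (n ∸ m)
  product m = cong₂ _*_ (pairs≡2*C2 m) (pairs≡2*C2 (n ∸ m))
  spread : ∀ a b c d e f → 4 * (a * b + c * d + e * f) ≡ 2 * a * (2 * b) + 2 * c * (2 * d) + 2 * e * (2 * f)
  spread = solve-∀

turanSum≡4*turanBound : ∀ n₁ n₂ n₃ → turanSum n₁ n₂ n₃ ≡ 4 * turanBound (n₁ + n₂ + n₃) n₁ n₂ n₃
turanSum≡4*turanBound n₁ n₂ n₃ = sym (trans (4*turanBound (n₁ + n₂ + n₃) n₁ n₂ n₃)
  (cong₂ _+_ (cong₂ _+_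
    (cong (λ x → pairs n₁ * pairs x) (remove {m = n₁} (n₂ + n₃) (+-assoc n₁ n₂ n₃)))
    (cong (λ x → pairs n₂ * pairs x) (remove {m = n₂} (n₁ + n₃) (rotate n₁ n₂ n₃))))
    (cong (λ x → pairs n₃ * pairs x) (remove {m = n₃} (n₁ + n₂) (+-comm (n₁ + n₂) n₃)))))
  where
  remove : ∀ {n m} l → n ≡ m + l → n ∸ m ≡ l
  remove {m = m} l refl = m+n∸m≡n m l
  rotate : ∀ a b c → a + b + c ≡ b + (a + c)
  rotate = solve-∀

-- If `n₃` were at most 2, the other parts would be at most 3 and the total at most 8.
smallest-part : ∀ {n₁ n₂ n₃} → 9 ≤ n₁ + n₂ + n₃ → n₂ ≤ n₁ → n₁ ≤ suc n₃ → 3 ≤ n₃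
smallest-part {n₁} {n₂} {n₃} 9≤n n₂≤n₁ n₁≤ = ≮⇒≥ λ n₃<3 → <⇒≱ 9≤n
  (+-mono-≤ (+-mono-≤ (≤-trans n₁≤ n₃<3) (≤-trans n₂≤n₁ (≤-trans n₁≤ n₃<3))) (≤-pred n₃<3))

turan-maximises : ∀ {n n₁ n₂ n₃} → 9 ≤ n → n₁ + n₂ + n₃ ≡ n → n₂ ≤ n₁ → n₃ ≤ n₂ → n₁ ≤ suc n₃ →
  (G : Colouring n) →
  copiesH G ≤ turanBound n n₁ n₂ n₃ ×
  (copiesH G ≡ turanBound n n₁ n₂ n₃ ⇔ RedIsCompleteTripartite G n₁ n₂ n₃)
turan-maximises {n} {n₁} {n₂} {n₃} 9≤n refl n₂≤n₁ n₃≤n₂ n₁≤ G =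
  *-cancelˡ-≤ 4 (subst₂ _≤_ (sym 4*copiesH) 4*turan (proj₁ extremal)) ,
  mk⇔ (λ e → triangle⇒tripartite refl (proj₂ extremal (trans (sym 4*copiesH) (trans (cong (4 *_) e) (sym 4*turan)))))
      (λ t → *-cancelˡ-≡ _ _ 4 (trans 4*copiesH (trans (tripartite-sum t) (sym (4*turanBound n n₁ n₂ n₃)))))
  where
  open Graph G
  4*turan : turanSum n₁ n₂ n₃ ≡ 4 * turanBound n n₁ n₂ n₃
  4*turan = turanSum≡4*turanBound n₁ n₂ n₃
  extremal : Extremal.Extremal G (turanSum n₁ n₂ n₃) n₁ n₂ n₃
  extremal = Extremal.extremal G (smallest-part 9≤n n₂≤n₁ n₁≤) refl n₂≤n₁ n₃≤n₂ n₁≤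

theorem8p1 : Σ ℕ λ n₀ → ∀ n → n₀ ≤ n →
    ∀ n₁ n₂ n₃ → 1 ≤ n₁ → 1 ≤ n₂ → 1 ≤ n₃ → n₁ + n₂ + n₃ ≡ n →
    n₂ ≤ n₁ → n₃ ≤ n₂ → n₁ ≤ suc n₃ →
    (col : Colouring n) →
    (copiesH col ≤ turanBound n n₁ n₂ n₃) ×
    ((copiesH col ≡ turanBound n n₁ n₂ n₃) ⇔ RedIsCompleteTripartite col n₁ n₂ n₃)
-- From 9 vertices on, the smallest part m is at least 3, as the parametrisation m = k + 3 requires.
theorem8p1 = 9 , λ n 9≤n n₁ n₂ n₃ _ _ _ sum-n n₂≤n₁ n₃≤n₂ n₁≤ col →
  turan-maximises 9≤n sum-n n₂≤n₁ n₃≤n₂ n₁≤ col
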